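{- For every odd integer $d\ge 3$ and every prime power $q\ge d+2$, $$M(q,q-d-1)\ \ge\ \mathcal{S}_d(q)+N^m_{\frac{d+3}{2},\frac{d+1}{2}}(q).$$
   Context: For permutations $\pi,\sigma$ of the same $n$ symbols, the Hamming distance $hd(\pi,\sigma)$ is the number of positions $x$ with $\pi(x)\ne\sigma(x)$. $M(n,D)$ is the maximum size of a set of permutations on $n$ symbols in which any two distinct permutations have Hamming distance at least $D$. Let $q$ be a prime power, $\mathbb{F}_q$ the field with $q$ elements and $\mathcal{P}^1(\mathbb{F}_q)=\mathbb{F}_q\cup\{\infty\}$. Let $V,U$ be nonzero polynomials over $\mathbb{F}_q$ with $\gcd(V,U)=1$, of degrees $v,u$ and leading coefficients $a_v,b_u$. The rational function $V(x)/U(x)$ is evaluated on $\mathcal{P}^1(\mathbb{F}_q)$ as follows: at $a\in\mathbb{F}_q$ its value is $V(a)/U(a)$, understood as $\infty$ if $U(a)=0$; at $\infty$ its value is $\infty$ if $v>u$, $0$ if $v<u$, and $a_v/b_v$ if $v=u$. It is a permutation rational function (PRF) if it permutes $\mathcal{P}^1(\mathbb{F}_q)$. $P_{v,u}(q)$ is the set of PRFs $V(x)/U(x)$ (as rational functions, so $V/U$ and $(cV)/(cU)$ with $c\in\mathbb{F}_q\setminus\{0\}$ are the same element) with $\deg V=v$ and $\deg U=u$, and $N_{v,u}(q)=|P_{v,u}(q)|$. $N^m_{v,u}(q)$ is the number of PRFs $V(x)/U(x)$ in $P_{v,u}(q)$ with both $V$ and $U$ monic. For odd $d$, $\mathcal{S}_d(q)=\sum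 N_{v,u}(q)$, the sum being over all pairs $(v,u)$ of non-negative integers such that: $v\le (d+1)/2$ if $v>u$; $u\le (d-3)/2$ if $v<u$; and $v=u\le (d-3)/2$ if $v=u$. -}

module Defs where

open import Algebra.Core using (Op₁; Op₂)
open import Algebra.Structures using (IsCommutativeRing)
open import Data.Fin.Base using (Fin; zero)
import Data.Fin.Properties as Fin
open import Data.Fin.Permutation using (Permutation′; _⟨$⟩ʳ_; _≈_; insert)
import Data.Fin.Permutation as Perm
open import Data.List.Base
  using (List; []; _∷_; _++_; map; length; filter; upTo; allFin; concatMap; foldr;
         deduplicate; cartesianProduct; cartesianProductWith)
open import Data.List.Extrema.Nat using (max)
open import Data.List.Membership.Propositional using (_∈_; lose)
open import Data.List.Membership.Propositional.Properties
  using (∈-map⁺; ∈-allFin; ∈-upTo⁺; ∈-cartesianProductWith⁺; ∈-concatMap⁺)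
open import Data.List.Properties using (≡-dec; length-map)
open import Data.List.Relation.Unary.All as All using ()
open import Data.List.Relation.Unary.AllPairs using (AllPairs; allPairs?)
open import Data.List.Relation.Unary.Any as Any using (here; there)
open import Data.Maybe.Base using (Maybe; just; nothing)
import Data.Maybe.Properties as Maybe
open import Data.Nat.Base as ℕ using (ℕ; zero; suc; _≤_; _<_; _∸_; _^_; _/_; s≤s; z≤n)
open import Data.Nat.ListAction using (sum)
import Data.Nat.Properties as ℕ
open import Data.Nat.Primality using (Prime)
open import Data.Product.Base using (∃; ∃₂; _×_; _,_; proj₁; proj₂)
open import Function.Bundles using (_↔_; module Inverse)
open import Function.Definitions using (Bijective)
open import Function.Properties.Inverse using (Inverse⇒Injection)
open import Relation.Binary.Definitions using (DecidableEquality; tri<; tri≈; tri>)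
open import Relation.Binary.PropositionalEquality using (_≡_; _≢_; refl; subst)
open import Relation.Nullary using (¬_; Dec; yes; no; ¬?)
open import Relation.Nullary.Decidable using (map′; _×-dec_; _→-dec_; via-injection)
open import Relation.Unary using (Decidable)

hd : ∀ {n} → Permutation′ n → Permutation′ n → ℕ
hd {n} π σ = length (filter (λ x → ¬? (π ⟨$⟩ʳ x Fin.≟ σ ⟨$⟩ʳ x)) (allFin n))

-- A list standing for a set: its entries are distinct as functions.
IsCode : ∀ {n} → ℕ → List (Permutation′ n) → Set
IsCode D = AllPairs (λ π σ → ¬ (π ≈ σ) × D ≤ hd π σ)

isCode? : ∀ {n} D → Decidable (IsCode {n} D)
isCode? D = allPairs? λ π σ →
  ¬? (Fin.all? λ x → π ⟨$⟩ʳ x Fin.≟ σ ⟨$⟩ʳ x) ×-dec (D ℕ.≤? hd π σ)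

-- Exhaustive up to _≈_, because π ≈ insert zero (π ⟨$⟩ʳ zero) (remove zero π)
-- by insert-remove.
permutations : ∀ n → List (Permutation′ n)
permutations zero    = Perm.id ∷ []
permutations (suc n) = cartesianProductWith (insert zero) (allFin (suc n)) (permutations n)

sublists : ∀ {A : Set} → List A → List (List A)
sublists []       = [] ∷ []
sublists (x ∷ xs) = map (x ∷_) (sublists xs) ++ sublists xs

M : ℕ → ℕ → ℕ
M n D = max 0 (map length (filter (isCode? D) (sublists (permutations n))))

IsPrimePower : ℕ → Set
IsPrimePower q = ∃₂ λ p k → Prime p × 1 ≤ k × q ≡ p ^ k

record FiniteField (q : ℕ) : Set₁ where
  infix  8 _⁻¹
  infixl 7 _*_
  infixl 6 _+_
  field
    Carrier           : Set
    _+_ _*_           : Op₂ Carrier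
    -_                : Op₁ Carrier
    0# 1#             : Carrier
    isCommutativeRing : IsCommutativeRing _≡_ _+_ _*_ -_ 0# 1#
    0≢1               : 0# ≢ 1#
    _⁻¹               : Op₁ Carrier          -- 0# ⁻¹ is unconstrained
    *-inverseʳ        : ∀ x → x ≢ 0# → x * x ⁻¹ ≡ 1#
    enumeration       : Carrier ↔ Fin q

  infix 4 _≟_
  _≟_ : DecidableEquality Carrier
  _≟_ = via-injection (Inverse⇒Injection enumeration) Fin._≟_

  elements : List Carrier
  elements = map (Inverse.from enumeration) (allFin q)

  ∈-elements : ∀ x → x ∈ elements
  ∈-elements x = subst (_∈ elements) (Inverse.strictlyInverseʳ enumeration x)
    (∈-map⁺ (Inverse.from enumeration) (∈-allFin (Inverse.to enumeration x)))

module _ {q : ℕ} (F : FiniteField q) where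
  open FiniteField F

  -- Coefficients with the constant term first.  Nonzero polynomials are meant
  -- to be normalised (last coefficient nonzero), see HasDegree; for these,
  -- equality of polynomials is _≡_.
  Poly : Set
  Poly = List Carrier

  lead : Poly → Carrier
  lead []              = 0#
  lead (a ∷ [])        = a
  lead (_ ∷ p@(_ ∷ _)) = lead p

  HasDegree : Poly → ℕ → Set
  HasDegree p n = length p ≡ suc n × lead p ≢ 0#

  Monic : Poly → Set
  Monic p = lead p ≡ 1#

  eval : Poly → Carrier → Carrier
  eval p x = foldr (λ a y → a + x * y) 0# p

  scale : Carrier → Poly → Poly
  scale c = map (c *_)

  _+ₚ_ : Poly → Poly → Poly
  []      +ₚ q       = q
  (a ∷ p) +ₚ []      = a ∷ p
  (a ∷ p) +ₚ (b ∷ q) = (a + b) ∷ (p +ₚ q)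

  _*ₚ_ : Poly → Poly → Poly
  []      *ₚ q = []
  (a ∷ p) *ₚ q = scale a q +ₚ (0# ∷ (p *ₚ q))

  -- If V is normalised and nonzero, W *ₚ Q ≡ V forces W and Q to be so too,
  -- because the last entry of W *ₚ Q is the product of their last entries.
  _∣ₚ_ : Poly → Poly → Set
  W ∣ₚ V = ∃ λ Q → W *ₚ Q ≡ V

  -- gcd(V,U) = 1: every common divisor divides 1.
  Coprime : Poly → Poly → Set
  Coprime V U = ∀ W → W ∣ₚ V → W ∣ₚ U → W ∣ₚ (1# ∷ [])

  -- The projective line, with nothing as the point at infinity.
  ℙ¹ : Set
  ℙ¹ = Maybe Carrier

  RatFun : Set
  RatFun = Poly × Poly

  -- V(x)/U(x) on ℙ¹; for normalised nonzero polynomials, lengths compare as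
  -- degrees do.
  ⟦_⟧ : RatFun → ℙ¹ → ℙ¹
  ⟦ V , U ⟧ (just a) with eval U a ≟ 0#
  ... | yes _ = nothing
  ... | no  _ = just (eval V a * eval U a ⁻¹)
  ⟦ V , U ⟧ nothing with ℕ.<-cmp (length V) (length U)
  ... | tri< _ _ _ = just 0#
  ... | tri≈ _ _ _ = just (lead V * lead U ⁻¹)
  ... | tri> _ _ _ = nothing

  IsPRF : ℕ → ℕ → RatFun → Set
  IsPRF v u r@(V , U) =
    HasDegree V v × HasDegree U u × Coprime V U × Bijective _≡_ _≡_ ⟦ r ⟧

  IsMonicPRF : ℕ → ℕ → RatFun → Set
  IsMonicPRF v u r@(V , U) = IsPRF v u r × Monic V × Monic U

  -- For coprime pairs this is equality of rational functions.
  _≈ᵣ_ : RatFun → RatFun → Set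
  (V , U) ≈ᵣ (V′ , U′) = ∃ λ c → c ≢ 0# × V′ ≡ scale c V × U′ ≡ scale c U

  _≟ₚ_ : DecidableEquality Poly
  _≟ₚ_ = ≡-dec _≟_

  listsOf : ℕ → List Poly
  listsOf zero    = [] ∷ []
  listsOf (suc n) = cartesianProductWith _∷_ elements (listsOf n)

  ∈-listsOf : ∀ p → p ∈ listsOf (length p)
  ∈-listsOf []      = here refl
  ∈-listsOf (a ∷ p) = ∈-cartesianProductWith⁺ _∷_ (∈-elements a) (∈-listsOf p)

  listsUpTo : ℕ → List Poly
  listsUpTo n = concatMap listsOf (upTo (suc n))

  ∈-listsUpTo : ∀ p {n} → length p ≤ n → p ∈ listsUpTo n
  ∈-listsUpTo p |p|≤n =
    ∈-concatMap⁺ listsOf (lose (∈-upTo⁺ (s≤s |p|≤n)) (∈-listsOf p))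

  length-+ₚˡ : ∀ p q → length p ≤ length (p +ₚ q)
  length-+ₚˡ []      q       = z≤n
  length-+ₚˡ (a ∷ p) []      = ℕ.≤-refl
  length-+ₚˡ (a ∷ p) (b ∷ q) = s≤s (length-+ₚˡ p q)

  length-+ₚʳ : ∀ p q → length q ≤ length (p +ₚ q)
  length-+ₚʳ []      q       = ℕ.≤-refl
  length-+ₚʳ (a ∷ p) []      = z≤n
  length-+ₚʳ (a ∷ p) (b ∷ q) = s≤s (length-+ₚʳ p q)

  length-*ₚˡ : ∀ p q → length p ≤ length (p *ₚ q)
  length-*ₚˡ []      q = z≤n
  length-*ₚˡ (a ∷ p) q =
    ℕ.≤-trans (s≤s (length-*ₚˡ p q)) (length-+ₚʳ (scale a q) (0# ∷ (p *ₚ q)))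

  length-*ₚʳ : ∀ a p q → length q ≤ length ((a ∷ p) *ₚ q)
  length-*ₚʳ a p q = subst (_≤ length ((a ∷ p) *ₚ q)) (length-map (a *_) q)
    (length-+ₚˡ (scale a q) (0# ∷ (p *ₚ q)))

  ∣ₚ⇒length≤ : ∀ W V → W ∣ₚ V → length W ≤ length V
  ∣ₚ⇒length≤ W _ (Q , refl) = length-*ₚˡ W Q

  _∣ₚ?_ : ∀ W V → Dec (W ∣ₚ V)
  []      ∣ₚ? V = map′ ([] ,_) proj₂ ([] ≟ₚ V)
  (a ∷ p) ∣ₚ? V = map′ Any.satisfied complete
    (Any.any? (λ Q → ((a ∷ p) *ₚ Q) ≟ₚ V) (listsUpTo (length V)))
    where
    complete : (a ∷ p) ∣ₚ V → Any.Any (λ Q → (a ∷ p) *ₚ Q ≡ V) (listsUpTo (length V))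
    complete (Q , refl) = lose (∈-listsUpTo Q (length-*ₚʳ a p Q)) refl

  coprime? : ∀ V U → Dec (Coprime V U)
  coprime? V U = map′
    (λ all W W∣V → All.lookup all (∈-listsUpTo W (∣ₚ⇒length≤ W V W∣V)) W∣V)
    (λ cop → All.tabulate (λ {W} _ → cop W))
    (All.all? (λ W → (W ∣ₚ? V) →-dec ((W ∣ₚ? U) →-dec (W ∣ₚ? (1# ∷ []))))
              (listsUpTo (length V)))

  _≟∞_ : DecidableEquality ℙ¹
  _≟∞_ = Maybe.≡-dec _≟_

  points : List ℙ¹
  points = nothing ∷ map just elements

  ∈-points : ∀ x → x ∈ points
  ∈-points nothing  = here refl
  ∈-points (just a) = there (∈-map⁺ just (∈-elements a))

  ∀-points? : ∀ {P : ℙ¹ → Set} → Decidable P → Dec (∀ x → P x)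
  ∀-points? P? = map′ (λ all x → All.lookup all (∈-points x))
                      (λ p → All.tabulate (λ {x} _ → p x)) (All.all? P? points)

  ∃-points? : ∀ {P : ℙ¹ → Set} → Decidable P → Dec (∃ P)
  ∃-points? P? = map′ Any.satisfied (λ (x , px) → lose (∈-points x) px) (Any.any? P? points)

  bijective? : (f : ℙ¹ → ℙ¹) → Dec (Bijective _≡_ _≡_ f)
  bijective? f = map′
    (λ (inj , sur) → (λ {x} {y} → inj x y) , λ y → proj₁ (sur y) , λ { refl → proj₂ (sur y) })
    (λ (inj , sur) → (λ x y → inj) , λ y → proj₁ (sur y) , proj₂ (sur y) refl)
    (∀-points? (λ x → ∀-points? λ y → (f x ≟∞ f y) →-dec (x ≟∞ y))
      ×-dec ∀-points? (λ y → ∃-points? λ x → f x ≟∞ y))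

  hasDegree? : ∀ p n → Dec (HasDegree p n)
  hasDegree? p n = (length p ℕ.≟ suc n) ×-dec ¬? (lead p ≟ 0#)

  isPRF? : ∀ v u → Decidable (IsPRF v u)
  isPRF? v u r@(V , U) =
    hasDegree? V v ×-dec hasDegree? U u ×-dec coprime? V U ×-dec bijective? ⟦ r ⟧

  isMonicPRF? : ∀ v u → Decidable (IsMonicPRF v u)
  isMonicPRF? v u r@(V , U) = isPRF? v u r ×-dec (lead V ≟ 1#) ×-dec (lead U ≟ 1#)

  _≈ᵣ?_ : ∀ r s → Dec (r ≈ᵣ s)
  (V , U) ≈ᵣ? (V′ , U′) = map′ Any.satisfied
    (λ (c , p) → lose (∈-elements c) p)
    (Any.any? (λ c → ¬? (c ≟ 0#) ×-dec (V′ ≟ₚ scale c V) ×-dec (U′ ≟ₚ scale c U)) elements)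

  candidates : ℕ → ℕ → List RatFun
  candidates v u = cartesianProduct (listsOf (suc v)) (listsOf (suc u))

  N : ℕ → ℕ → ℕ
  N v u = length (deduplicate _≈ᵣ?_ (filter (isPRF? v u) (candidates v u)))

  -- Counts rational functions having a representative with both parts monic.
  Nᵐ : ℕ → ℕ → ℕ
  Nᵐ v u = length (deduplicate _≈ᵣ?_ (filter (isMonicPRF? v u) (candidates v u)))

Admissible : ℕ → ℕ × ℕ → Set
Admissible d (v , u) =
  (u < v → v ≤ (d ℕ.+ 1) / 2) × (v < u → u ≤ (d ∸ 3) / 2) × (v ≡ u → u ≤ (d ∸ 3) / 2)

admissible? : ∀ d → Decidable (Admissible d)
admissible? d (v , u) =
  ((u ℕ.<? v) →-dec (v ℕ.≤? (d ℕ.+ 1) / 2)) ×-dec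
  ((v ℕ.<? u) →-dec (u ℕ.≤? (d ∸ 3) / 2)) ×-dec
  ((v ℕ.≟ u) →-dec (u ℕ.≤? (d ∸ 3) / 2))

-- An admissible pair has both entries at most (d + 1) / 2, so none is missed.
admissiblePairs : ℕ → List (ℕ × ℕ)
admissiblePairs d = filter (admissible? d) (cartesianProduct range range)
  where
  range : List ℕ
  range = upTo (suc ((d ℕ.+ 1) / 2))

S : ∀ {q} → FiniteField q → ℕ → ℕ
S F d = sum (map (λ (v , u) → N F v u) (admissiblePairs d))

{-# OPTIONS --safe #-}

-- Put k = (d + 1) / 2.  Every PRF f induces a permutation of the field by deleting ∞ from
-- its cycle.  If f = V/U and g = R/T, these permutations can agree only at a finite pole
-- of f or g or at a root of VT − RU, and VT − RU ≠ 0 when f ≠ g because both fractions are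
-- reduced.  Let e ≤ 1 be the number of finite poles of f, so e = 0 if deg V > deg U.  The
-- PRFs counted by S satisfy deg V + e ≤ k and deg U + e < k; the monic ones of degrees
-- (k + 1, k) have e = 0, and for two of them the leading terms of VT and RU cancel.  In all
-- cases there are at most 2k = d + 1 agreements.
module Submission where

open import Defs
import Algebra.Properties.CommutativeSemigroup as CommutativeSemigroupProperties
import Algebra.Properties.Ring as RingProperties
open import Algebra.Bundles using (CommutativeRing)
open import Data.Empty using (⊥-elim)
open import Data.Fin.Base using (Fin; zero; suc; punchIn)
import Data.Fin.Properties as Fin
open import Data.Fin.Permutation
  using (Permutation′; _⟨$⟩ʳ_; insert; remove; insert-punchIn; insert-remove)
  renaming (_≈_ to _≈π_)
import Data.Fin.Permutation as Perm
open import Data.List.Base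
  using (List; []; _∷_; _++_; map; length; filter; take; allFin; fromMaybe; concatMap;
         deduplicate; upTo; cartesianProduct)
open import Data.List.Extrema.Nat using (v≤max⁺)
open import Data.List.Membership.Propositional using (_∈_; find; lose)
open import Data.List.Membership.Propositional.Properties
  using (∈-map⁺; ∈-++⁺ˡ; ∈-++⁺ʳ; ∈-allFin; ∈-filter⁺)
open import Data.List.Properties
  using (length-map; length-take; length-tabulate; length-++; filter-≐; filter-none)
open import Data.List.Relation.Unary.All as All using (All; []; _∷_)
import Data.List.Relation.Unary.All.Properties as All
open import Data.List.Relation.Unary.AllPairs as AllPairs using (AllPairs; []; _∷_)
import Data.List.Relation.Unary.AllPairs.Properties as AllPairs
open import Data.List.Relation.Unary.Any as Any using (Any; here; there; any?)
import Data.List.Relation.Unary.Any.Properties as Any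
open import Data.List.Relation.Unary.Unique.Propositional using (Unique)
import Data.List.Relation.Unary.Unique.Propositional.Properties as Unique
import Data.List.Relation.Unary.Unique.Setoid.Properties as UniqueSetoid
open import Data.Maybe.Base as Maybe using (Maybe; just; nothing)
import Data.Maybe.Properties as Maybe
open import Data.Nat.Base as ℕ
  using (ℕ; zero; suc; _≤_; _<_; _≥_; z≤n; s≤s; _∸_; _⊔_; _/_; _%_)
import Data.Nat.DivMod as ℕ
open import Data.Nat.ListAction using (sum)
import Data.Nat.Properties as ℕ
open import Data.Product.Base using (Σ; ∃; ∃₂; _×_; _,_; proj₁; proj₂)
open import Data.Sum.Base using (_⊎_; inj₁; inj₂)
open import Function.Base using (_∘_)
open import Function.Bundles using (_↔_; module Inverse; mk↔ₛ′)
open import Function.Construct.Composition using (_↔-∘_)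
open import Function.Construct.Symmetry using (↔-sym)
open import Function.Definitions using (Bijective)
open import Level using (0ℓ)
open import Relation.Binary.Bundles using (Setoid)
open import Relation.Binary.Definitions using (tri<; tri≈; tri>)
open import Relation.Binary.PropositionalEquality
  using (_≡_; _≢_; refl; sym; trans; cong; cong₂; subst; setoid; module ≡-Reasoning)
import Relation.Binary.Reasoning.Setoid as SetoidReasoning
open import Relation.Nullary using (¬_; yes; no; ¬?)
open import Relation.Unary using (Decidable; Pred)

-- Let e and e′ count the finite poles of f and g. Agreements number at most max(deg V + deg T, deg
-- R + deg U) + e + e′. Charging e to both degrees of f and e′ to both degrees of g splits this into
-- conditions on f and on g separately; hence the bounds on deg V + e and deg U + e. The strict one
-- leaves the unit of room that a numerator of degree k + 1 takes up. Two encodings shape the rest.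
-- `Coprime` speaks only of common divisors, and of lists up to `≡`, so VT = RU is not cancelled by
-- a Bézout identity: Euclid's algorithm exhibits both fractions as multiples of one pair, and the
-- multipliers must then be constants. And `M` is a maximum over sublists of one fixed list, so the
-- code must be carried to that list up to `≈π` without losing members; this is where q ≥ d + 2
-- enters, since a positive distance keeps the members apart.

module _ {B : Set} where

  Any-remove : ∀ {P Q : Pred B 0ℓ} {ys} (q : Any Q ys) → (∀ {y} → P y → ¬ Q y) →
    Any P ys → Any P (ys Any.─ q)
  Any-remove (here qy) P∩Q=∅ (here py) = ⊥-elim (P∩Q=∅ py qy)
  Any-remove (here qy) P∩Q=∅ (there p) = p
  Any-remove (there q) P∩Q=∅ (here py) = here py
  Any-remove (there q) P∩Q=∅ (there p) = there (Any-remove q P∩Q=∅ p)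

  length-remove : ∀ {Q : Pred B 0ℓ} {ys} (q : Any Q ys) → length ys ≡ suc (length (ys Any.─ q))
  length-remove (here _)  = refl
  length-remove (there q) = cong suc (length-remove q)

module _ {A B : Set} {R : A → B → Set} where

  -- Pigeonhole by deletion: the match found for the head is struck from `ys`, and the later matches
  -- survive because a `y` is never related to two entries of `xs`.
  length-≤-matching : ∀ {xs ys} → AllPairs (λ x x′ → ∀ {y} → R x y → ¬ R x′ y) xs →
    All (λ x → Any (R x) ys) xs → length xs ≤ length ys
  length-≤-matching []              []            = z≤n
  length-≤-matching (apart ∷ aparts) (m ∷ matches) = subst (_ ≤_) (sym (length-remove m))
    (s≤s (length-≤-matching aparts
      (All.zipWith (λ (x#x′ , m′) → Any-remove m (λ Rx′y Rxy → x#x′ Rxy Rx′y) m′) (apart , matches))))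

Unique-⊆⇒length-≤ : ∀ {A : Set} {xs ys : List A} → Unique xs → All (_∈ ys) xs → length xs ≤ length ys
Unique-⊆⇒length-≤ xs! = length-≤-matching
  (AllPairs.map (λ x≢x′ {y} x≡y x′≡y → x≢x′ (trans x≡y (sym x′≡y))) xs!)

module _ {A : Set} {P : Pred A 0ℓ} (P? : Decidable P) where

  length-filter-complement : ∀ xs → length (filter P? xs) ℕ.+ length (filter (¬? ∘ P?) xs) ≡ length xs
  length-filter-complement []       = refl
  length-filter-complement (x ∷ xs) with P? x
  ... | yes _ = cong suc (length-filter-complement xs)
  ... | no  _ = trans (ℕ.+-suc _ _) (cong suc (length-filter-complement xs))

  filter-∈-sublists : ∀ xs → filter P? xs ∈ sublists xs
  filter-∈-sublists []       = here refl
  filter-∈-sublists (x ∷ xs) with P? x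
  ... | yes _ = ∈-++⁺ˡ (∈-map⁺ (x ∷_) (filter-∈-sublists xs))
  ... | no  _ = ∈-++⁺ʳ (map (x ∷_) (sublists xs)) (filter-∈-sublists xs)

module _ {A : Set} {R : A → A → Set} where

  AllPairs-mapWith : ∀ {P : Pred A 0ℓ} {S : A → A → Set} {xs} →
    (∀ {x y} → P x → P y → R x y → S x y) → All P xs → AllPairs R xs → AllPairs S xs
  AllPairs-mapWith f []         []           = []
  AllPairs-mapWith f (px ∷ pxs) (Rx ∷ Rxs) =
    All.zipWith (λ (py , Rxy) → f px py Rxy) (pxs , Rx) ∷ AllPairs-mapWith f pxs Rxs

  -- Meant for two permutations represented in a code: they represent either the same codeword or
  -- two codewords whose distance is known. Symmetry of `R` absorbs the order in which the two
  -- positions occur.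
  AllPairs-lookup : ∀ {P Q : Pred A 0ℓ} {xs} → (∀ {x y} → R x y → R y x) → AllPairs R xs →
    Any P xs → Any Q xs → (∃ λ x → P x × Q x) ⊎ (∃₂ λ x y → P x × Q y × R x y)
  AllPairs-lookup R-sym (Rx ∷ Rxs) (here px) (here qx) = inj₁ (_ , px , qx)
  AllPairs-lookup R-sym (Rx ∷ Rxs) (here px) (there q) =
    let qy , Rxy = All.lookupAny Rx q in inj₂ (_ , _ , px , Rxy , qy)
  AllPairs-lookup R-sym (Rx ∷ Rxs) (there p) (here qx) =
    let Rxy , py = All.lookupAny Rx p in inj₂ (_ , _ , py , qx , R-sym Rxy)
  AllPairs-lookup R-sym (Rx ∷ Rxs) (there p) (there q) = AllPairs-lookup R-sym Rxs p q

-- Permutations, codes and the maximum M(n, D)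

module _ {n : ℕ} where

  ≈π-setoid : Setoid 0ℓ 0ℓ
  ≈π-setoid = record
    { Carrier       = Permutation′ n
    ; _≈_           = _≈π_
    ; isEquivalence = record
      { refl  = λ i → refl
      ; sym   = λ π≈σ i → sym (π≈σ i)
      ; trans = λ π≈σ σ≈τ i → trans (π≈σ i) (σ≈τ i)
      }
    }

  agreements : Permutation′ n → Permutation′ n → List (Fin n)
  agreements π σ = filter (λ x → π ⟨$⟩ʳ x Fin.≟ σ ⟨$⟩ʳ x) (allFin n)

  agreements+hd : ∀ π σ → length (agreements π σ) ℕ.+ hd π σ ≡ n
  agreements+hd π σ =
    trans (length-filter-complement (λ x → π ⟨$⟩ʳ x Fin.≟ σ ⟨$⟩ʳ x) (allFin n)) (length-tabulate _)

  agreements≤⇒hd≥ : ∀ {m} π σ → length (agreements π σ) ≤ m → n ∸ m ≤ hd π σ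
  agreements≤⇒hd≥ {m} π σ agree≤m = ℕ.m≤n+o⇒m∸n≤o n m
    (ℕ.≤-trans (ℕ.≤-reflexive (sym (agreements+hd π σ))) (ℕ.+-monoˡ-≤ _ agree≤m))

  differ? : (π σ : Permutation′ n) → Decidable (λ x → ¬ (π ⟨$⟩ʳ x ≡ σ ⟨$⟩ʳ x))
  differ? π σ x = ¬? (π ⟨$⟩ʳ x Fin.≟ σ ⟨$⟩ʳ x)

  hd-cong : ∀ {π π′ σ σ′ : Permutation′ n} → π ≈π π′ → σ ≈π σ′ → hd π σ ≡ hd π′ σ′
  hd-cong {π} {π′} {σ} {σ′} π≈π′ σ≈σ′ = cong length (filter-≐ (differ? π σ) (differ? π′ σ′)
    ( (λ {x} πx≢σx π′x≡σ′x → πx≢σx (trans (π≈π′ x) (trans π′x≡σ′x (sym (σ≈σ′ x)))))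
    , (λ {x} π′x≢σ′x πx≡σx → π′x≢σ′x (trans (sym (π≈π′ x)) (trans πx≡σx (σ≈σ′ x)))))
    (allFin n))

  hd-sym : ∀ (π σ : Permutation′ n) → hd π σ ≡ hd σ π
  hd-sym π σ = cong length
    (filter-≐ (differ? π σ) (differ? σ π) ((λ πx≢σx → πx≢σx ∘ sym) , (λ σx≢πx → σx≢πx ∘ sym)) (allFin n))

  hd-≈ : ∀ {π σ : Permutation′ n} → π ≈π σ → hd π σ ≡ 0
  hd-≈ {π} {σ} π≈σ = cong length (filter-none (differ? π σ)
    {allFin n} (All.tabulate λ {x} _ πx≢σx → πx≢σx (π≈σ x)))

insert-zero-cong : ∀ {n} j {π σ : Permutation′ n} → π ≈π σ → insert zero j π ≈π insert zero j σ
insert-zero-cong j         π≈σ zero    = refl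
insert-zero-cong j {π} {σ} π≈σ (suc i) = trans (insert-punchIn zero j π i)
  (trans (cong (punchIn j) (π≈σ i)) (sym (insert-punchIn zero j σ i)))

-- The image of `zero` reveals `j`; the other images are those of `π` under the injection
-- `punchIn j`.
insert-zero-injective : ∀ {n} {j k} {π σ : Permutation′ n} →
  insert zero j π ≈π insert zero k σ → j ≡ k × π ≈π σ
insert-zero-injective {j = j} {k} {π} {σ} eq with eq zero
... | refl = refl , λ i → Fin.punchIn-injective j _ _
  (trans (sym (insert-punchIn zero j π i)) (trans (eq (suc i)) (insert-punchIn zero j σ i)))

permutations-complete : ∀ {n} (π : Permutation′ n) → Any (π ≈π_) (permutations n)
permutations-complete {zero}  π = here λ ()
permutations-complete {suc n} π = Any.cartesianProductWith⁺ (insert zero)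
  (λ { {y = σ} refl removed≈σ i → trans (sym (insert-remove zero π i))
         (insert-zero-cong (π ⟨$⟩ʳ zero) {remove zero π} {σ} removed≈σ i) })
  (∈-allFin (π ⟨$⟩ʳ zero)) (permutations-complete (remove zero π))

permutations-distinct : ∀ n → AllPairs (λ π σ → ¬ (π ≈π σ)) (permutations n)
permutations-distinct zero    = [] ∷ []
permutations-distinct (suc n) = UniqueSetoid.cartesianProductWith⁺
  (setoid (Fin (suc n))) ≈π-setoid ≈π-setoid (insert zero)
  (λ {_} {_} {π} {σ} → insert-zero-injective {π = π} {σ})
  (Unique.allFin⁺ (suc n)) (permutations-distinct n)

-- The entries of `C` need not occur in `permutations n`, so `C` is replaced by the sublist `C′` of
-- those listed permutations that are pointwise equal to one of its members. A positive `D` excludes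
-- that two positions of `C` share a representative, so nothing is lost.
code⇒length≤M : ∀ {n D} (C : List (Permutation′ n)) → 1 ≤ D →
  AllPairs (λ π σ → D ≤ hd π σ) C → length C ≤ M n D
code⇒length≤M {n} {D} C 1≤D C-code = v≤max⁺ 0 _ (inj₂ (Any.map⁺
  (lose (∈-filter⁺ (isCode? D) (filter-∈-sublists inC? (permutations n)) C′-code) |C|≤|C′|)))
  where
  InC : Permutation′ n → Set
  InC π = Any (π ≈π_) C

  inC? : Decidable InC
  inC? π = any? (λ σ → Fin.all? λ x → π ⟨$⟩ʳ x Fin.≟ σ ⟨$⟩ʳ x) C

  C′ : List (Permutation′ n)
  C′ = filter inC? (permutations n)

  far⇒≉ : ∀ {π σ : Permutation′ n} → D ≤ hd π σ → ¬ (π ≈π σ)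
  far⇒≉ {π} {σ} D≤hd π≈σ = ℕ.<⇒≱ 1≤D (subst (D ≤_) (hd-≈ {π = π} {σ} π≈σ) D≤hd)

  far : ∀ {π σ : Permutation′ n} → InC π → InC σ → ¬ (π ≈π σ) → ¬ (π ≈π σ) × D ≤ hd π σ
  far {π} {σ} π∈C σ∈C π≉σ
    with AllPairs-lookup (λ {ρ} {τ} → subst (D ≤_) (hd-sym ρ τ)) C-code π∈C σ∈C
  ... | inj₁ (τ , π≈τ , σ≈τ) = ⊥-elim (π≉σ λ i → trans (π≈τ i) (sym (σ≈τ i)))
  ... | inj₂ (π′ , σ′ , π≈π′ , σ≈σ′ , D≤hd) =
    π≉σ , subst (D ≤_) (sym (hd-cong {π = π} {π′} {σ} {σ′} π≈π′ σ≈σ′)) D≤hd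

  C′-code : IsCode D C′
  C′-code = AllPairs-mapWith (λ {π} {σ} → far {π} {σ}) (All.all-filter inC? (permutations n))
    (AllPairs.filter⁺ inC? (permutations-distinct n))

  |C|≤|C′| : length C ≤ length C′
  |C|≤|C′| = length-≤-matching {R = _≈π_}
    (AllPairs.map (λ {π} {σ} D≤hd {τ} π≈τ σ≈τ →
      far⇒≉ {π} {σ} D≤hd λ i → trans (π≈τ i) (sym (σ≈τ i))) C-code)
    (All.tabulate λ {π} π∈C →
      let σ , σ∈permutations , π≈σ = find (permutations-complete π)
      in lose (∈-filter⁺ inC? σ∈permutations (lose π∈C λ i → sym (π≈σ i))) π≈σ)

length-concatMap : ∀ {A B : Set} (f : A → List B) xs → length (concatMap f xs) ≡ sum (map (length ∘ f) xs)
length-concatMap f []       = refl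
length-concatMap f (x ∷ xs) = trans (length-++ (f x)) (cong (length (f x) ℕ.+_) (length-concatMap f xs))

-- Polynomial arithmetic up to trailing zeros

module Polynomials {q : ℕ} (F : FiniteField q) where
  open FiniteField F

  commutativeRing : CommutativeRing 0ℓ 0ℓ
  commutativeRing = record { isCommutativeRing = isCommutativeRing }

  module K where
    open CommutativeRing commutativeRing public
      using (+-comm; +-assoc; +-identityˡ; +-identityʳ; *-comm; *-assoc; *-identityˡ;
             *-identityʳ; zeroˡ; zeroʳ; distribˡ; distribʳ; -‿inverseʳ)
    open RingProperties (CommutativeRing.ring commutativeRing) public
      using (-0#≈0#; -‿distribˡ-*; -‿distribʳ-*; +-cancelˡ; x∙y⁻¹≈ε⇒x≈y; -‿+-comm)
    open CommutativeSemigroupProperties (CommutativeRing.+-commutativeSemigroup commutativeRing) public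
      using () renaming (interchange to +-interchange)
    open CommutativeSemigroupProperties (CommutativeRing.*-commutativeSemigroup commutativeRing) public
      using () renaming (x∙yz≈y∙xz to x*[y*z]≡y*[x*z])

  *-cancelˡ-nonzero : ∀ {x y z} → x ≢ 0# → x * y ≡ x * z → y ≡ z
  *-cancelˡ-nonzero {x} {y} {z} x≢0 xy≡xz = begin
    y                ≡⟨ unit y ⟨
    x ⁻¹ * (x * y)   ≡⟨ cong (x ⁻¹ *_) xy≡xz ⟩
    x ⁻¹ * (x * z)   ≡⟨ unit z ⟩
    z                ∎
    where
    open ≡-Reasoning
    unit : ∀ w → x ⁻¹ * (x * w) ≡ w
    unit w = trans (K.x*[y*z]≡y*[x*z] (x ⁻¹) x w)
      (trans (sym (K.*-assoc x (x ⁻¹) w))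
      (trans (cong (_* w) (*-inverseʳ x x≢0)) (K.*-identityˡ w)))

  x*y≡0⇒y≡0 : ∀ {x y} → x ≢ 0# → x * y ≡ 0# → y ≡ 0#
  x*y≡0⇒y≡0 {x} x≢0 xy≡0 = *-cancelˡ-nonzero x≢0 (trans xy≡0 (sym (K.zeroʳ x)))

  *-nonzero : ∀ {x y} → x ≢ 0# → y ≢ 0# → x * y ≢ 0#
  *-nonzero x≢0 y≢0 xy≡0 = y≢0 (x*y≡0⇒y≡0 x≢0 xy≡0)

  Pol : Set
  Pol = Poly F

  infix  8 ⊝_
  infixl 7 _⊗_ _·_
  infixl 6 _⊕_
  infix  4 _≈_

  _⊕_ _⊗_ : Pol → Pol → Pol
  _⊕_ = _+ₚ_ F
  _⊗_ = _*ₚ_ F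

  _·_ : Carrier → Pol → Pol
  _·_ = scale F

  ⊝_ : Pol → Pol
  ⊝_ = map (-_)

  coeff : Pol → ℕ → Carrier
  coeff []      i       = 0#
  coeff (a ∷ p) zero    = a
  coeff (a ∷ p) (suc i) = coeff p i

  -- Equality of polynomials up to trailing zero coefficients.
  record _≈_ (p r : Pol) : Set where
    constructor coeffwise
    field at : ∀ i → coeff p i ≡ coeff r i
  open _≈_ public

  ≈-setoid : Setoid 0ℓ 0ℓ
  ≈-setoid = record
    { Carrier       = Pol
    ; _≈_           = _≈_
    ; isEquivalence = record
      { refl  = coeffwise λ i → refl
      ; sym   = λ p≈q → coeffwise λ i → sym (at p≈q i)
      ; trans = λ p≈q q≈r → coeffwise λ i → trans (at p≈q i) (at q≈r i)
      }
    }

  open Setoid ≈-setoid public using ()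
    renaming (refl to ≈-refl; sym to ≈-sym; trans to ≈-trans)
  module ≈-Reasoning = SetoidReasoning ≈-setoid

  coeff-⊕ : ∀ p r i → coeff (p ⊕ r) i ≡ coeff p i + coeff r i
  coeff-⊕ []      r       i       = sym (K.+-identityˡ _)
  coeff-⊕ (a ∷ p) []      i       = sym (K.+-identityʳ _)
  coeff-⊕ (a ∷ p) (b ∷ r) zero    = refl
  coeff-⊕ (a ∷ p) (b ∷ r) (suc i) = coeff-⊕ p r i

  coeff-· : ∀ c p i → coeff (c · p) i ≡ c * coeff p i
  coeff-· c []      i       = sym (K.zeroʳ c)
  coeff-· c (a ∷ p) zero    = refl
  coeff-· c (a ∷ p) (suc i) = coeff-· c p i

  coeff-⊝ : ∀ p i → coeff (⊝ p) i ≡ - coeff p i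
  coeff-⊝ []      i       = sym K.-0#≈0#
  coeff-⊝ (a ∷ p) zero    = refl
  coeff-⊝ (a ∷ p) (suc i) = coeff-⊝ p i

  ∷-cong : ∀ {a b p r} → a ≡ b → p ≈ r → a ∷ p ≈ b ∷ r
  ∷-cong a≡b p≈r = coeffwise λ { zero → a≡b ; (suc i) → at p≈r i }

  tail-≈[] : ∀ {a p} → a ∷ p ≈ [] → p ≈ []
  tail-≈[] a∷p≈[] = coeffwise λ i → at a∷p≈[] (suc i)

  0∷[]≈[] : ∀ {p} → p ≈ [] → 0# ∷ p ≈ []
  0∷[]≈[] p≈[] = coeffwise λ { zero → refl ; (suc i) → at p≈[] i }

  ⊕-cong : ∀ {p p′ r r′} → p ≈ p′ → r ≈ r′ → p ⊕ r ≈ p′ ⊕ r′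
  ⊕-cong {p} {p′} {r} {r′} p≈p′ r≈r′ = coeffwise λ i →
    trans (coeff-⊕ p r i) (trans (cong₂ _+_ (at p≈p′ i) (at r≈r′ i)) (sym (coeff-⊕ p′ r′ i)))

  ⊕-congˡ : ∀ p {r r′} → r ≈ r′ → p ⊕ r ≈ p ⊕ r′
  ⊕-congˡ p = ⊕-cong ≈-refl

  ⊕-congʳ : ∀ {p p′} r → p ≈ p′ → p ⊕ r ≈ p′ ⊕ r
  ⊕-congʳ r p≈p′ = ⊕-cong p≈p′ ≈-refl

  ⊕-comm : ∀ p r → p ⊕ r ≈ r ⊕ p
  ⊕-comm p r = coeffwise λ i →
    trans (coeff-⊕ p r i) (trans (K.+-comm _ _) (sym (coeff-⊕ r p i)))

  ⊕-assoc : ∀ p r s → (p ⊕ r) ⊕ s ≈ p ⊕ (r ⊕ s)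
  ⊕-assoc p r s = coeffwise λ i → begin
    coeff (p ⊕ r ⊕ s) i                   ≡⟨ coeff-⊕ (p ⊕ r) s i ⟩
    coeff (p ⊕ r) i + coeff s i           ≡⟨ cong (_+ coeff s i) (coeff-⊕ p r i) ⟩
    coeff p i + coeff r i + coeff s i     ≡⟨ K.+-assoc _ _ _ ⟩
    coeff p i + (coeff r i + coeff s i)   ≡⟨ cong (coeff p i +_) (coeff-⊕ r s i) ⟨
    coeff p i + coeff (r ⊕ s) i           ≡⟨ coeff-⊕ p (r ⊕ s) i ⟨
    coeff (p ⊕ (r ⊕ s)) i                 ∎
    where open ≡-Reasoning

  ⊕-identityʳ : ∀ p → p ⊕ [] ≈ p
  ⊕-identityʳ p = coeffwise λ i → trans (coeff-⊕ p [] i) (K.+-identityʳ _)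

  ⊝-inverseʳ : ∀ p → p ⊕ ⊝ p ≈ []
  ⊝-inverseʳ p = coeffwise λ i →
    trans (coeff-⊕ p (⊝ p) i) (trans (cong (coeff p i +_) (coeff-⊝ p i)) (K.-‿inverseʳ _))

  ⊕-cancelˡ : ∀ p {r s} → p ⊕ r ≈ p ⊕ s → r ≈ s
  ⊕-cancelˡ p {r} {s} pr≈ps = coeffwise λ i → K.+-cancelˡ (coeff p i) _ _
    (trans (sym (coeff-⊕ p r i)) (trans (at pr≈ps i) (coeff-⊕ p s i)))

  ⊕-interchange : ∀ p r s t → (p ⊕ r) ⊕ (s ⊕ t) ≈ (p ⊕ s) ⊕ (r ⊕ t)
  ⊕-interchange p r s t = coeffwise λ i →
    trans (trans (coeff-⊕ (p ⊕ r) (s ⊕ t) i) (cong₂ _+_ (coeff-⊕ p r i) (coeff-⊕ s t i)))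
    (trans (K.+-interchange _ _ _ _)
    (sym (trans (coeff-⊕ (p ⊕ s) (r ⊕ t) i) (cong₂ _+_ (coeff-⊕ p s i) (coeff-⊕ r t i)))))

  ·-cong : ∀ {c p p′} → p ≈ p′ → c · p ≈ c · p′
  ·-cong {c} {p} {p′} p≈p′ = coeffwise λ i →
    trans (coeff-· c p i) (trans (cong (c *_) (at p≈p′ i)) (sym (coeff-· c p′ i)))

  ·-distribˡ-⊕ : ∀ c p r → c · (p ⊕ r) ≈ c · p ⊕ c · r
  ·-distribˡ-⊕ c p r = coeffwise λ i → begin
    coeff (c · (p ⊕ r)) i                 ≡⟨ coeff-· c (p ⊕ r) i ⟩
    c * coeff (p ⊕ r) i                   ≡⟨ cong (c *_) (coeff-⊕ p r i) ⟩
    c * (coeff p i + coeff r i)           ≡⟨ K.distribˡ _ _ _ ⟩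
    c * coeff p i + c * coeff r i         ≡⟨ cong₂ _+_ (coeff-· c p i) (coeff-· c r i) ⟨
    coeff (c · p) i + coeff (c · r) i     ≡⟨ coeff-⊕ (c · p) (c · r) i ⟨
    coeff (c · p ⊕ c · r) i               ∎
    where open ≡-Reasoning

  ·-* : ∀ c d p → c · (d · p) ≈ (c * d) · p
  ·-* c d p = coeffwise λ i → begin
    coeff (c · (d · p)) i   ≡⟨ coeff-· c (d · p) i ⟩
    c * coeff (d · p) i     ≡⟨ cong (c *_) (coeff-· d p i) ⟩
    c * (d * coeff p i)     ≡⟨ K.*-assoc c d _ ⟨
    c * d * coeff p i       ≡⟨ coeff-· (c * d) p i ⟨
    coeff ((c * d) · p) i   ∎
    where open ≡-Reasoning

  1· : ∀ p → 1# · p ≈ p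
  1· p = coeffwise λ i → trans (coeff-· 1# p i) (K.*-identityˡ _)

  0· : ∀ p → 0# · p ≈ []
  0· p = coeffwise λ i → trans (coeff-· 0# p i) (K.zeroˡ _)

  ⊗-congˡ : ∀ p {r r′} → r ≈ r′ → p ⊗ r ≈ p ⊗ r′
  ⊗-congˡ []      r≈r′ = ≈-refl
  ⊗-congˡ (a ∷ p) r≈r′ = ⊕-cong (·-cong r≈r′) (∷-cong refl (⊗-congˡ p r≈r′))

  ⊗-zeroʳ : ∀ p → p ⊗ [] ≈ []
  ⊗-zeroʳ []      = ≈-refl
  ⊗-zeroʳ (a ∷ p) = 0∷[]≈[] (⊗-zeroʳ p)

  -- `⊗` recurses on its left factor; this is the same recursion on the right one, and it makes
  -- commutativity an induction.
  ⊗-∷ : ∀ p b r → p ⊗ (b ∷ r) ≈ b · p ⊕ (0# ∷ p ⊗ r)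
  ⊗-∷ []      b r = coeffwise λ { zero → refl ; (suc i) → refl }
  ⊗-∷ (a ∷ p) b r = ∷-cong (cong (_+ 0#) (K.*-comm a b)) (begin
    a · r ⊕ p ⊗ (b ∷ r)              ≈⟨ ⊕-congˡ (a · r) (⊗-∷ p b r) ⟩
    a · r ⊕ (b · p ⊕ (0# ∷ p ⊗ r))   ≈⟨ ⊕-assoc (a · r) _ _ ⟨
    a · r ⊕ b · p ⊕ (0# ∷ p ⊗ r)     ≈⟨ ⊕-congʳ _ (⊕-comm (a · r) (b · p)) ⟩
    b · p ⊕ a · r ⊕ (0# ∷ p ⊗ r)     ≈⟨ ⊕-assoc (b · p) _ _ ⟩
    b · p ⊕ (a · r ⊕ (0# ∷ p ⊗ r))   ∎)
    where open ≈-Reasoning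

  ⊗-comm : ∀ p r → p ⊗ r ≈ r ⊗ p
  ⊗-comm []      r = ≈-sym (⊗-zeroʳ r)
  ⊗-comm (a ∷ p) r = ≈-trans (⊕-congˡ (a · r) (∷-cong refl (⊗-comm p r))) (≈-sym (⊗-∷ r a p))

  -- Passing through commutativity avoids a recursion on two lists that may differ in length by
  -- trailing zeros.
  ⊗-congʳ : ∀ {p p′} r → p ≈ p′ → p ⊗ r ≈ p′ ⊗ r
  ⊗-congʳ {p} {p′} r p≈p′ =
    ≈-trans (⊗-comm p r) (≈-trans (⊗-congˡ r p≈p′) (⊗-comm r p′))

  ⊗-cong : ∀ {p p′ r r′} → p ≈ p′ → r ≈ r′ → p ⊗ r ≈ p′ ⊗ r′
  ⊗-cong {p′ = p′} {r} p≈p′ r≈r′ = ≈-trans (⊗-congʳ r p≈p′) (⊗-congˡ p′ r≈r′)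

  ⊗-distribˡ-⊕ : ∀ p r s → p ⊗ (r ⊕ s) ≈ p ⊗ r ⊕ p ⊗ s
  ⊗-distribˡ-⊕ []      r s = ≈-refl
  ⊗-distribˡ-⊕ (a ∷ p) r s = ≈-trans
    (⊕-cong (·-distribˡ-⊕ a r s)
            (∷-cong (sym (K.+-identityʳ 0#)) (⊗-distribˡ-⊕ p r s)))
    (⊕-interchange (a · r) (a · s) (0# ∷ p ⊗ r) (0# ∷ p ⊗ s))

  ⊗-distribʳ-⊕ : ∀ p r s → (r ⊕ s) ⊗ p ≈ r ⊗ p ⊕ s ⊗ p
  ⊗-distribʳ-⊕ p r s = ≈-trans (⊗-comm (r ⊕ s) p)
    (≈-trans (⊗-distribˡ-⊕ p r s) (⊕-cong (⊗-comm p r) (⊗-comm p s)))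

  ·-⊗ : ∀ c p r → (c · p) ⊗ r ≈ c · (p ⊗ r)
  ·-⊗ c []      r = ≈-refl
  ·-⊗ c (a ∷ p) r = begin
    (c * a) · r ⊕ (0# ∷ (c · p) ⊗ r)   ≈⟨ ⊕-cong (≈-sym (·-* c a r)) (∷-cong (sym (K.zeroʳ c)) (·-⊗ c p r)) ⟩
    c · (a · r) ⊕ c · (0# ∷ p ⊗ r)     ≈⟨ ·-distribˡ-⊕ c (a · r) _ ⟨
    c · (a · r ⊕ (0# ∷ p ⊗ r))         ∎
    where open ≈-Reasoning

  ⊗-assoc : ∀ p r s → (p ⊗ r) ⊗ s ≈ p ⊗ (r ⊗ s)
  ⊗-assoc []      r s = ≈-refl
  ⊗-assoc (a ∷ p) r s = begin
    (a · r ⊕ (0# ∷ p ⊗ r)) ⊗ s           ≈⟨ ⊗-distribʳ-⊕ s (a · r) _ ⟩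
    (a · r) ⊗ s ⊕ (0# ∷ p ⊗ r) ⊗ s       ≈⟨ ⊕-cong (·-⊗ a r s) (⊕-congʳ _ (0· s)) ⟩
    a · (r ⊗ s) ⊕ (0# ∷ (p ⊗ r) ⊗ s)     ≈⟨ ⊕-congˡ (a · (r ⊗ s)) (∷-cong refl (⊗-assoc p r s)) ⟩
    a · (r ⊗ s) ⊕ (0# ∷ p ⊗ (r ⊗ s))     ∎
    where open ≈-Reasoning

  constant-⊗ : ∀ c {p} r → p ≈ [] → (c ∷ p) ⊗ r ≈ c · r
  constant-⊗ c {p} r p≈[] =
    ≈-trans (⊕-congˡ (c · r) (0∷[]≈[] (⊗-congʳ {p} r p≈[]))) (⊕-identityʳ (c · r))

  ⊗-identityʳ : ∀ p → p ⊗ (1# ∷ []) ≈ p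
  ⊗-identityʳ p = ≈-trans (⊗-comm p _) (≈-trans (constant-⊗ 1# p ≈-refl) (1· p))

  p⊕⊝r≈[]⇒p≈r : ∀ {p r} → p ⊕ ⊝ r ≈ [] → p ≈ r
  p⊕⊝r≈[]⇒p≈r {p} {r} p-r≈[] = coeffwise λ i → K.x∙y⁻¹≈ε⇒x≈y _ _
    (trans (sym (trans (coeff-⊕ p (⊝ r) i) (cong (coeff p i +_) (coeff-⊝ r i)))) (at p-r≈[] i))

  -- Evaluation, synthetic division and roots

  ev : Pol → Carrier → Carrier
  ev = eval F

  eval-⊕ : ∀ p r x → ev (p ⊕ r) x ≡ ev p x + ev r x
  eval-⊕ []      r       x = sym (K.+-identityˡ _)
  eval-⊕ (a ∷ p) []      x = sym (K.+-identityʳ _)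
  eval-⊕ (a ∷ p) (b ∷ r) x = begin
    a + b + x * ev (p ⊕ r) x           ≡⟨ cong (λ y → a + b + x * y) (eval-⊕ p r x) ⟩
    a + b + x * (ev p x + ev r x)      ≡⟨ cong (a + b +_) (K.distribˡ x _ _) ⟩
    a + b + (x * ev p x + x * ev r x)  ≡⟨ K.+-interchange a b _ _ ⟩
    ev (a ∷ p) x + ev (b ∷ r) x        ∎
    where open ≡-Reasoning

  eval-· : ∀ c p x → ev (c · p) x ≡ c * ev p x
  eval-· c []      x = sym (K.zeroʳ c)
  eval-· c (a ∷ p) x = begin
    c * a + x * ev (c · p) x    ≡⟨ cong (λ y → c * a + x * y) (eval-· c p x) ⟩
    c * a + x * (c * ev p x)    ≡⟨ cong (c * a +_) (K.x*[y*z]≡y*[x*z] x c _) ⟩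
    c * a + c * (x * ev p x)    ≡⟨ K.distribˡ c a _ ⟨
    c * (a + x * ev p x)        ∎
    where open ≡-Reasoning

  eval-⊝ : ∀ p x → ev (⊝ p) x ≡ - ev p x
  eval-⊝ []      x = sym K.-0#≈0#
  eval-⊝ (a ∷ p) x = begin
    - a + x * ev (⊝ p) x   ≡⟨ cong (λ y → - a + x * y) (eval-⊝ p x) ⟩
    - a + x * - ev p x     ≡⟨ cong (- a +_) (K.-‿distribʳ-* x _) ⟨
    - a + - (x * ev p x)   ≡⟨ K.-‿+-comm a _ ⟩
    - (a + x * ev p x)     ∎
    where open ≡-Reasoning

  eval-⊗ : ∀ p r x → ev (p ⊗ r) x ≡ ev p x * ev r x
  eval-⊗ []      r x = sym (K.zeroˡ _)
  eval-⊗ (a ∷ p) r x = begin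
    ev (a · r ⊕ (0# ∷ p ⊗ r)) x                 ≡⟨ eval-⊕ (a · r) _ x ⟩
    ev (a · r) x + (0# + x * ev (p ⊗ r) x)      ≡⟨ cong₂ _+_ (eval-· a r x) (K.+-identityˡ _) ⟩
    a * ev r x + x * ev (p ⊗ r) x               ≡⟨ cong (λ y → a * ev r x + x * y) (eval-⊗ p r x) ⟩
    a * ev r x + x * (ev p x * ev r x)          ≡⟨ cong (a * ev r x +_) (K.*-assoc x _ _) ⟨
    a * ev r x + x * ev p x * ev r x            ≡⟨ K.distribʳ _ a _ ⟨
    (a + x * ev p x) * ev r x                   ∎
    where open ≡-Reasoning

  eval-≈[] : ∀ {p} x → p ≈ [] → ev p x ≡ 0#
  eval-≈[] {[]}    x p≈[] = refl
  eval-≈[] {a ∷ p} x p≈[] = trans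
    (cong₂ (λ b y → b + x * y) (at p≈[] 0) (eval-≈[] x (tail-≈[] p≈[])))
    (trans (K.+-identityˡ _) (K.zeroʳ x))

  eval-cong : ∀ {p r} x → p ≈ r → ev p x ≡ ev r x
  eval-cong {[]}    {r}     x p≈r = sym (eval-≈[] x (≈-sym p≈r))
  eval-cong {a ∷ p} {[]}    x p≈r = eval-≈[] x p≈r
  eval-cong {a ∷ p} {b ∷ r} x p≈r = cong₂ (λ c y → c + x * y) (at p≈r 0)
    (eval-cong {p} {r} x (coeffwise λ i → at p≈r (suc i)))

  -- Synthetic division: the quotient of p by x − a, without its remainder.
  quotientAt : Carrier → Pol → Pol
  quotientAt a []                = []
  quotientAt a (b ∷ [])          = []
  quotientAt a (b ∷ p@(_ ∷ _))   = ev p a ∷ quotientAt a p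

  length-quotientAt : ∀ a b p → length (quotientAt a (b ∷ p)) ≡ length p
  length-quotientAt a b []      = refl
  length-quotientAt a b (c ∷ p) = cong suc (length-quotientAt a c p)

  -- The quotient lists the values at `a` of the nonempty proper tails of the polynomial. If they
  -- all vanish, the entries after `b` vanish one by one, starting from the end.
  quotientAt-zero : ∀ a b p → quotientAt a (b ∷ p) ≈ [] → p ≈ []
  quotientAt-zero a b []      quo≈[] = ≈-refl
  quotientAt-zero a b (c ∷ p) quo≈[] = ≈-trans (∷-cong c≡0 p≈[]) (0∷[]≈[] ≈-refl)
    where
    p≈[] : p ≈ []
    p≈[] = quotientAt-zero a c p (tail-≈[] quo≈[])
    c≡0 : c ≡ 0#
    c≡0 = begin
      c               ≡⟨ K.+-identityʳ c ⟨
      c + 0#          ≡⟨ cong (c +_) (trans (cong (a *_) (eval-≈[] a p≈[])) (K.zeroʳ a)) ⟨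
      c + a * ev p a  ≡⟨ at quo≈[] 0 ⟩
      0#              ∎
      where open ≡-Reasoning

  -- This is p(x) - p(a) = (x - a) r(x), with r the quotient, rearranged so that no negation occurs.
  eval-quotientAt : ∀ a p x →
    ev p x + a * ev (quotientAt a p) x ≡ ev p a + x * ev (quotientAt a p) x
  eval-quotientAt a []            x =
    cong (0# +_) (trans (K.zeroʳ a) (sym (K.zeroʳ x)))
  eval-quotientAt a (b ∷ [])      x = cong₂ (λ y z → b + y + z)
    (trans (K.zeroʳ x) (sym (K.zeroʳ a))) (trans (K.zeroʳ a) (sym (K.zeroʳ x)))
  eval-quotientAt a (b ∷ p@(_ ∷ _)) x = begin
    b + x * p[x] + a * (p[a] + x * r)      ≡⟨ cong (b + x * p[x] +_) (K.distribˡ a _ _) ⟩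
    b + x * p[x] + (a * p[a] + a * (x * r))   ≡⟨ K.+-interchange b _ _ _ ⟩
    b + a * p[a] + (x * p[x] + a * (x * r))
      ≡⟨ cong (λ y → b + a * p[a] + (x * p[x] + y)) (K.x*[y*z]≡y*[x*z] a x r) ⟩
    b + a * p[a] + (x * p[x] + x * (a * r))   ≡⟨ cong (b + a * p[a] +_) (K.distribˡ x _ _) ⟨
    b + a * p[a] + x * (p[x] + a * r)         ≡⟨ cong (λ y → b + a * p[a] + x * y) (eval-quotientAt a p x) ⟩
    b + a * p[a] + x * (p[a] + x * r)         ∎
    where
    open ≡-Reasoning
    p[x] = ev p x
    p[a] = ev p a
    r    = ev (quotientAt a p) x

  root-quotientAt : ∀ {a x} p → a ≢ x → ev p a ≡ 0# → ev p x ≡ 0# →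
    ev (quotientAt a p) x ≡ 0#
  root-quotientAt {a} {x} p a≢x p[a]≡0 p[x]≡0 =
    x*y≡0⇒y≡0 (λ a-x≡0 → a≢x (K.x∙y⁻¹≈ε⇒x≈y a x a-x≡0)) (begin
      (a + - x) * r              ≡⟨ K.distribʳ r a (- x) ⟩
      a * r + - x * r            ≡⟨ cong₂ _+_ ar≡xr (sym (K.-‿distribˡ-* x r)) ⟩
      x * r + - (x * r)          ≡⟨ K.-‿inverseʳ (x * r) ⟩
      0#                         ∎)
    where
    open ≡-Reasoning
    r = ev (quotientAt a p) x
    ar≡xr : a * r ≡ x * r
    ar≡xr = begin
      a * r               ≡⟨ K.+-identityˡ _ ⟨
      0# + a * r          ≡⟨ cong (_+ a * r) p[x]≡0 ⟨
      ev p x + a * r      ≡⟨ eval-quotientAt a p x ⟩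
      ev p a + x * r      ≡⟨ cong (_+ x * r) p[a]≡0 ⟩
      0# + x * r          ≡⟨ K.+-identityˡ _ ⟩
      x * r               ∎

  Root : Pol → Carrier → Set
  Root p x = ev p x ≡ 0#

  -- Dividing out the first root shortens the list by one, and the other roots, being different from
  -- it, remain roots of the quotient. A zero quotient leaves a constant, which the first root
  -- forces to be zero.
  manyRoots⇒≈[] : ∀ p {xs} → Unique xs → All (Root p) xs → length p ≤ length xs → p ≈ []
  manyRoots⇒≈[] []      xs!          roots           _          = ≈-refl
  manyRoots⇒≈[] (b ∷ p) (x∉xs ∷ xs!) (root ∷ roots) (s≤s |p|≤|xs|) =
    ≈-trans (∷-cong b≡0 p≈[]) (0∷[]≈[] ≈-refl)
    where
    -- The wildcard is solved to the head of the list of roots, the one that is divided out.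
    a = _
    quotient = quotientAt a (b ∷ p)
    p≈[] : p ≈ []
    p≈[] = quotientAt-zero a b p (manyRoots⇒≈[] quotient xs!
      (All.zipWith (λ (a≢x , root′) → root-quotientAt (b ∷ p) a≢x root root′) (x∉xs , roots))
      (subst (_≤ _) (sym (length-quotientAt a b p)) |p|≤|xs|))
    b≡0 : b ≡ 0#
    b≡0 = begin
      b                ≡⟨ K.+-identityʳ b ⟨
      b + 0#           ≡⟨ cong (b +_) (trans (cong (a *_) (eval-≈[] a p≈[])) (K.zeroʳ a)) ⟨
      b + a * ev p a   ≡⟨ root ⟩
      0#               ∎
      where open ≡-Reasoning

  -- Degree bounds and normalised polynomials

  record _below_ (p : Pol) (n : ℕ) : Set where
    constructor vanishing
    field vanishes : ∀ i → n ≤ i → coeff p i ≡ 0#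
  open _below_

  below-cong : ∀ {p r n} → p ≈ r → p below n → r below n
  below-cong p≈r p<n = vanishing λ i n≤i → trans (sym (at p≈r i)) (vanishes p<n i n≤i)

  below-mono : ∀ {p m n} → m ≤ n → p below m → p below n
  below-mono m≤n p<m = vanishing λ i n≤i → vanishes p<m i (ℕ.≤-trans m≤n n≤i)

  -- Degree bounds are sharpened by one here: after the subtraction in `division`, at a vanishing
  -- top coefficient in Euclid's algorithm, and when two monic products are subtracted.
  below-suc : ∀ {p n} → p below suc n → coeff p n ≡ 0# → p below n
  below-suc {p} {n} p<1+n pₙ≡0 = vanishing λ i n≤i → lemma i (ℕ.m≤n⇒m<n∨m≡n n≤i)
    where
    lemma : ∀ i → n < i ⊎ n ≡ i → coeff p i ≡ 0#
    lemma i (inj₁ n<i)  = vanishes p<1+n i n<i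
    lemma i (inj₂ refl) = pₙ≡0

  below-0⇒≈[] : ∀ {p} → p below 0 → p ≈ []
  below-0⇒≈[] p<0 = coeffwise λ i → vanishes p<0 i z≤n

  below-∷ : ∀ {a p n} → p below n → (a ∷ p) below suc n
  below-∷ p<n = vanishing λ { (suc i) (s≤s n≤i) → vanishes p<n i n≤i }

  below-length : ∀ p → p below length p
  below-length []      = vanishing λ _ _ → refl
  below-length (a ∷ p) = below-∷ (below-length p)

  below-⊕ : ∀ {p r n} → p below n → r below n → (p ⊕ r) below n
  below-⊕ {p} {r} p<n r<n = vanishing λ i n≤i → trans (coeff-⊕ p r i)
    (trans (cong₂ _+_ (vanishes p<n i n≤i) (vanishes r<n i n≤i)) (K.+-identityʳ 0#))

  below-· : ∀ {p n} c → p below n → (c · p) below n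
  below-· {p} c p<n = vanishing λ i n≤i →
    trans (coeff-· c p i) (trans (cong (c *_) (vanishes p<n i n≤i)) (K.zeroʳ c))

  below-⊝ : ∀ {p n} → p below n → (⊝ p) below n
  below-⊝ {p} p<n = vanishing λ i n≤i →
    trans (coeff-⊝ p i) (trans (cong (-_) (vanishes p<n i n≤i)) K.-0#≈0#)

  below-tail : ∀ {a p n} → (a ∷ p) below suc n → p below n
  below-tail p<n = vanishing λ i n≤i → vanishes p<n (suc i) (s≤s n≤i)

  below-⊗ : ∀ {p r m n} → p below suc m → r below suc n → (p ⊗ r) below suc (m ℕ.+ n)
  below-⊗ {[]} p<m r<n = vanishing λ _ _ → refl
  below-⊗ {a ∷ p} {r} {zero} {n} p<m r<n = below-cong
    (≈-sym (constant-⊗ a r (below-0⇒≈[] (below-tail p<m))))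
    (below-· a r<n)
  below-⊗ {a ∷ p} {r} {suc m} {n} p<m r<n = below-⊕
    (below-mono (s≤s (ℕ.m≤n+m n (suc m))) (below-· a r<n))
    (below-∷ (below-⊗ (below-tail p<m) r<n))

  coeff-⊗ : ∀ {p r m n} → p below suc m → r below suc n →
    coeff (p ⊗ r) (m ℕ.+ n) ≡ coeff p m * coeff r n
  coeff-⊗ {[]} p<m r<n = sym (K.zeroˡ _)
  coeff-⊗ {a ∷ p} {r} {zero} {n} p<m r<n = trans
    (at (constant-⊗ a r (below-0⇒≈[] (below-tail p<m))) n)
    (coeff-· a r n)
  coeff-⊗ {a ∷ p} {r} {suc m} {n} p<m r<n = begin
    coeff (a · r ⊕ (0# ∷ p ⊗ r)) (suc (m ℕ.+ n))         ≡⟨ coeff-⊕ (a · r) _ _ ⟩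
    coeff (a · r) (suc (m ℕ.+ n)) + coeff (p ⊗ r) (m ℕ.+ n)
      ≡⟨ cong₂ _+_ (vanishes (below-· a r<n) _ (s≤s (ℕ.m≤n+m n m))) (coeff-⊗ (below-tail p<m) r<n) ⟩
    0# + coeff p m * coeff r n                           ≡⟨ K.+-identityˡ _ ⟩
    coeff p m * coeff r n                                ∎
    where open ≡-Reasoning

  lead≡coeff : ∀ p {n} → length p ≡ suc n → lead F p ≡ coeff p n
  lead≡coeff (a ∷ [])        refl = refl
  lead≡coeff (a ∷ p@(_ ∷ _)) refl = lead≡coeff p refl

  take-below : ∀ {p n} → p below n → take n p ≈ p
  take-below {p}     {zero}  p<n = ≈-sym (below-0⇒≈[] p<n)
  take-below {[]}    {suc n} p<n = ≈-refl
  take-below {a ∷ p} {suc n} p<n = ∷-cong refl (take-below (below-tail p<n))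

  roots-≤-degree : ∀ {p n xs} → ¬ (p ≈ []) → p below suc n →
    Unique xs → All (Root p) xs → length xs ≤ n
  roots-≤-degree {p} {n} {xs} p≉[] p<1+n xs! roots with length xs ℕ.≤? n
  ... | yes |xs|≤n = |xs|≤n
  -- `manyRoots⇒≈[]` measures `p` by its list length, so any trailing zeros beyond index `n` are cut
  -- off first.
  ... | no  |xs|≰n = ⊥-elim (p≉[] (≈-trans (≈-sym take≈p) (manyRoots⇒≈[] (take (suc n) p) xs!
      (All.map (λ {x} → trans (eval-cong x take≈p)) roots)
      (ℕ.≤-trans (ℕ.≤-reflexive (length-take (suc n) p))
        (ℕ.≤-trans (ℕ.m⊓n≤m (suc n) (length p)) (ℕ.≰⇒> |xs|≰n))))))
    where
    take≈p : take (suc n) p ≈ p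
    take≈p = take-below p<1+n

  record Degree (p : Pol) (n : ℕ) : Set where
    constructor degree
    field hasDegree : HasDegree F p n
    length≡ : length p ≡ suc n
    length≡ = proj₁ hasDegree
    lead≢0 : lead F p ≢ 0#
    lead≢0 = proj₂ hasDegree
  open Degree

  Degree⇒coeff≢0 : ∀ {p n} → Degree p n → coeff p n ≢ 0#
  Degree⇒coeff≢0 {p} deg = subst (_≢ 0#) (lead≡coeff p (length≡ deg)) (lead≢0 deg)

  Degree⇒below : ∀ {p n} → Degree p n → p below suc n
  Degree⇒below {p} deg = subst (p below_) (length≡ deg) (below-length p)

  Degree⇒≉[] : ∀ {p n} → Degree p n → ¬ (p ≈ [])
  Degree⇒≉[] {n = n} deg p≈[] = Degree⇒coeff≢0 deg (at p≈[] n)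

  -- `∣ₚ` is an equality of lists, whereas the factors that Euclid's algorithm yields are known only
  -- up to `≈`; their trailing zeros must go before `Coprime` applies to them.
  normalise : ∀ p → p ≈ [] ⊎ ∃₂ λ p′ n → p′ ≈ p × Degree p′ n
  normalise []      = inj₁ ≈-refl
  normalise (a ∷ p) with normalise p | a ≟ 0#
  ... | inj₂ (p′@(_ ∷ _) , n , p′≈p , deg) | _ =
    inj₂ (a ∷ p′ , suc n , ∷-cong refl p′≈p , degree (cong suc (length≡ deg) , lead≢0 deg))
  ... | inj₁ p≈[] | yes a≡0 = inj₁ (≈-trans (∷-cong a≡0 p≈[]) (0∷[]≈[] ≈-refl))
  ... | inj₁ p≈[] | no  a≢0 = inj₂ (a ∷ [] , 0 , ∷-cong refl (≈-sym p≈[]) , degree (refl , a≢0))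

  length-⊕ : ∀ p r → length (p ⊕ r) ≡ length p ⊔ length r
  length-⊕ []      r       = refl
  length-⊕ (a ∷ p) []      = refl
  length-⊕ (a ∷ p) (b ∷ r) = cong suc (length-⊕ p r)

  length-⊗ : ∀ {p r m n} → length p ≡ suc m → length r ≡ suc n →
    length (p ⊗ r) ≡ suc (m ℕ.+ n)
  length-⊗ {a ∷ []} {b ∷ r} refl refl = cong suc (trans (length-⊕ (a · r) [])
    (trans (ℕ.⊔-identityʳ _) (length-map _ r)))
  length-⊗ {a ∷ p@(_ ∷ _)} {r} {suc m} {n} refl |r|≡1+n = begin
    length (a · r ⊕ (0# ∷ p ⊗ r))             ≡⟨ length-⊕ (a · r) _ ⟩
    length (a · r) ⊔ suc (length (p ⊗ r))
      ≡⟨ cong₂ (λ k l → k ⊔ suc l) (trans (length-map _ r) |r|≡1+n) (length-⊗ {p} {r} refl |r|≡1+n) ⟩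
    suc n ⊔ suc (suc m ℕ.+ n)
      ≡⟨ ℕ.m≤n⇒m⊔n≡n (s≤s (ℕ.m≤n+m n (suc m))) ⟩
    suc (suc m ℕ.+ n)                         ∎
    where open ≡-Reasoning

  -- The length of a product depends on the lengths of the factors alone, so only its last entry
  -- matters, and that is a product of two nonzero field elements.
  Degree-⊗ : ∀ {p r m n} → Degree p m → Degree r n → Degree (p ⊗ r) (m ℕ.+ n)
  Degree-⊗ {p} {r} {m} {n} deg-p deg-r = degree (|pr|≡ , subst (_≢ 0#) (sym lead≡)
    (*-nonzero (Degree⇒coeff≢0 deg-p) (Degree⇒coeff≢0 deg-r)))
    where
    |pr|≡ = length-⊗ {p} {r} (length≡ deg-p) (length≡ deg-r)
    lead≡ : lead F (p ⊗ r) ≡ coeff p m * coeff r n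
    lead≡ = trans (lead≡coeff (p ⊗ r) |pr|≡)
      (coeff-⊗ (Degree⇒below deg-p) (Degree⇒below deg-r))

  ⊗-zeroʳ⁻¹ : ∀ p r → ¬ (p ≈ []) → p ⊗ r ≈ [] → r ≈ []
  ⊗-zeroʳ⁻¹ p r p≉[] pr≈[] with normalise p | normalise r
  ... | inj₁ p≈[] | _ = ⊥-elim (p≉[] p≈[])
  ... | _ | inj₁ r≈[] = r≈[]
  ... | inj₂ (p′ , _ , p′≈p , deg-p′) | inj₂ (r′ , _ , r′≈r , deg-r′) =
    ⊥-elim (Degree⇒≉[] (Degree-⊗ deg-p′ deg-r′)
      (≈-trans (⊗-congʳ r′ p′≈p) (≈-trans (⊗-congˡ p r′≈r) pr≈[])))

  Degree-unique-≤ : ∀ {p r m n} → Degree p m → Degree r n → p ≈ r → m ≤ n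
  Degree-unique-≤ deg-p deg-r p≈r = ℕ.≮⇒≥ λ n<m →
    Degree⇒coeff≢0 deg-p (trans (at p≈r _) (vanishes (Degree⇒below deg-r) _ n<m))

  ≈∧length⇒≡ : ∀ {p r} → length p ≡ length r → p ≈ r → p ≡ r
  ≈∧length⇒≡ {[]}    {[]}    _         _   = refl
  ≈∧length⇒≡ {a ∷ p} {b ∷ r} |p|≡|r| p≈r = cong₂ _∷_ (at p≈r 0)
    (≈∧length⇒≡ (ℕ.suc-injective |p|≡|r|) (coeffwise λ i → at p≈r (suc i)))

  -- The way back from `≈` to the equality of lists in which `∣ₚ` and `≈ᵣ` are stated.
  Degree-≈⇒≡ : ∀ {p r m n} → Degree p m → Degree r n → p ≈ r → p ≡ r
  Degree-≈⇒≡ deg-p deg-r p≈r = ≈∧length⇒≡ (trans (length≡ deg-p) (trans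
    (cong suc (ℕ.≤-antisym (Degree-unique-≤ deg-p deg-r p≈r)
                           (Degree-unique-≤ deg-r deg-p (≈-sym p≈r))))
    (sym (length≡ deg-r)))) p≈r

  -- Division with remainder and equal fractions

  division : ∀ {u m} → u below suc m → coeff u m ≢ 0# →
    ∀ p → ∃₂ λ s r → p ≈ s ⊗ u ⊕ r × r below m
  division u<1+m uₘ≢0 []      = [] , [] , ≈-refl , vanishing λ _ _ → refl
  division {u} {m} u<1+m uₘ≢0 (a ∷ p) with division u<1+m uₘ≢0 p
  ... | s , r , p≈su+r , r<m = c ∷ s , ((a ∷ r) ⊕ ⊝ (c · u)) , a∷p≈ , remainder-below
    where
    open ≈-Reasoning
    -- From p = su + r follows a + xp = (xs)u + (a + xr), and a + xr has degree at most m. This `c`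
    -- makes `c · u` cancel its coefficient of index m.
    c = coeff (a ∷ r) m * (coeff u m) ⁻¹
    a∷p≈ : a ∷ p ≈ (c ∷ s) ⊗ u ⊕ ((a ∷ r) ⊕ ⊝ (c · u))
    a∷p≈ = ≈-sym (begin
      c · u ⊕ (0# ∷ s ⊗ u) ⊕ ((a ∷ r) ⊕ ⊝ (c · u))
        ≈⟨ ⊕-congˡ (c · u ⊕ (0# ∷ s ⊗ u)) (⊕-comm (a ∷ r) (⊝ (c · u))) ⟩
      c · u ⊕ (0# ∷ s ⊗ u) ⊕ (⊝ (c · u) ⊕ (a ∷ r))
        ≈⟨ ⊕-interchange (c · u) (0# ∷ s ⊗ u) (⊝ (c · u)) (a ∷ r) ⟩
      c · u ⊕ ⊝ (c · u) ⊕ (0# + a ∷ s ⊗ u ⊕ r)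
        ≈⟨ ⊕-cong (⊝-inverseʳ (c · u)) (∷-cong (K.+-identityˡ a) (≈-sym p≈su+r)) ⟩
      a ∷ p ∎)
    remainder-below : ((a ∷ r) ⊕ ⊝ (c · u)) below m
    remainder-below = below-suc
      (below-⊕ (below-∷ r<m) (below-⊝ (below-· c u<1+m)))
      (trans (coeff-⊕ (a ∷ r) (⊝ (c · u)) m)
      (trans (cong (coeff (a ∷ r) m +_) (trans (coeff-⊝ (c · u) m) (cong (-_) cuₘ≡)))
             (K.-‿inverseʳ _)))
      where
      cuₘ≡ : coeff (c · u) m ≡ coeff (a ∷ r) m
      cuₘ≡ = trans (coeff-· c u m) (trans (K.*-assoc _ _ _)
        (trans (cong (coeff (a ∷ r) m *_) (trans (K.*-comm _ _) (*-inverseʳ _ uₘ≢0)))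
               (K.*-identityʳ _)))

  -- Both fractions are multiples of the one pair (A, B). Thus `W` divides V and U while `C` divides
  -- R and T, the form in which coprimality can be used.
  record CommonShape (V U R T : Pol) : Set where
    field
      W C A B : Pol
      V≈WA : V ≈ W ⊗ A
      U≈WB : U ≈ W ⊗ B
      R≈CA : R ≈ C ⊗ A
      T≈CB : T ≈ C ⊗ B

  -- Euclid's algorithm run on V and U; the same quotients reduce R and T.
  proportional⇒commonShape : ∀ n {V U R T} → ¬ (V ≈ []) → U below n →
    V ⊗ T ≈ R ⊗ U → CommonShape V U R T
  -- Here U = 0, hence VT = 0 and T = 0 because V is nonzero: both fractions are multiples of (1,
  -- 0).
  proportional⇒commonShape zero {V} {U} {R} {T} V≉[] U<0 VT≈RU = record
    { W = V ; C = R ; A = 1# ∷ [] ; B = []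
    ; V≈WA = ≈-sym (⊗-identityʳ V)
    ; U≈WB = ≈-trans U≈[] (≈-sym (⊗-zeroʳ V))
    ; R≈CA = ≈-sym (⊗-identityʳ R)
    ; T≈CB = ≈-trans T≈[] (≈-sym (⊗-zeroʳ R))
    }
    where
    U≈[] = below-0⇒≈[] U<0
    T≈[] : T ≈ []
    T≈[] = ⊗-zeroʳ⁻¹ V T V≉[] (≈-trans VT≈RU (≈-trans (⊗-congˡ R U≈[]) (⊗-zeroʳ R)))
  proportional⇒commonShape (suc n) {V} {U} {R} {T} V≉[] U<1+n VT≈RU with coeff U n ≟ 0#
  ... | yes Uₙ≡0 = proportional⇒commonShape n V≉[] (below-suc U<1+n Uₙ≡0) VT≈RU
  ... | no  Uₙ≢0 with division U<1+n Uₙ≢0 V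
  -- The recursive call replaces (V, U) by (U, V′); reversing that turns (A, B) into (sA + B, A) and
  -- keeps the multipliers `W` and `C`.
  ... | s , V′ , V≈sU+V′ , V′<n = record
    { W = W ; C = C ; A = s ⊗ A ⊕ B ; B = A
    ; V≈WA = combine W V≈sU+V′ V≈WA U≈WB
    ; U≈WB = V≈WA
    ; R≈CA = combine C (≈-sym R≈sT+R′) R≈CA T≈CB
    ; T≈CB = R≈CA
    }
    where
    -- The quotient s comes from V and U, so nothing bounds the degree of `R′`; the recursion
    -- descends on the bound for the second entry of the first pair alone.
    R′ : Pol
    R′ = R ⊕ ⊝ (s ⊗ T)
    R≈sT+R′ : s ⊗ T ⊕ R′ ≈ R
    R≈sT+R′ = begin
      s ⊗ T ⊕ (R ⊕ ⊝ (s ⊗ T))   ≈⟨ ⊕-congˡ (s ⊗ T) (⊕-comm R _) ⟩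
      s ⊗ T ⊕ (⊝ (s ⊗ T) ⊕ R)   ≈⟨ ⊕-assoc (s ⊗ T) _ R ⟨
      s ⊗ T ⊕ ⊝ (s ⊗ T) ⊕ R     ≈⟨ ⊕-congʳ _ (⊝-inverseʳ (s ⊗ T)) ⟩
      R                         ∎
      where open ≈-Reasoning
    UR′≈TV′ : U ⊗ R′ ≈ T ⊗ V′
    -- Adding sTU turns the left side into RU and the right side into VT.
    UR′≈TV′ = ⊕-cancelˡ (s ⊗ (T ⊗ U)) (begin
      s ⊗ (T ⊗ U) ⊕ U ⊗ R′     ≈⟨ ⊕-cong (⊗-assoc s T U) (⊗-comm R′ U) ⟨
      s ⊗ T ⊗ U ⊕ R′ ⊗ U       ≈⟨ ⊗-distribʳ-⊕ U (s ⊗ T) R′ ⟨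
      (s ⊗ T ⊕ R′) ⊗ U         ≈⟨ ⊗-congʳ U R≈sT+R′ ⟩
      R ⊗ U                    ≈⟨ VT≈RU ⟨
      V ⊗ T                    ≈⟨ ⊗-congʳ T V≈sU+V′ ⟩
      (s ⊗ U ⊕ V′) ⊗ T         ≈⟨ ⊗-distribʳ-⊕ T (s ⊗ U) V′ ⟩
      s ⊗ U ⊗ T ⊕ V′ ⊗ T       ≈⟨ ⊕-cong (≈-trans (⊗-assoc s U T) (⊗-congˡ s (⊗-comm U T))) (⊗-comm V′ T) ⟩
      s ⊗ (T ⊗ U) ⊕ T ⊗ V′     ∎)
      where open ≈-Reasoning
    open CommonShape (proportional⇒commonShape n {U} {V′} {T} {R′}
      (λ U≈[] → Uₙ≢0 (at U≈[] n)) V′<n UR′≈TV′)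
    combine : ∀ {X P Q} D → X ≈ s ⊗ P ⊕ Q → P ≈ D ⊗ A → Q ≈ D ⊗ B → X ≈ D ⊗ (s ⊗ A ⊕ B)
    combine {X} {P} {Q} D X≈sP+Q P≈DA Q≈DB = begin
      X                         ≈⟨ X≈sP+Q ⟩
      s ⊗ P ⊕ Q                 ≈⟨ ⊕-cong (⊗-congˡ s P≈DA) Q≈DB ⟩
      s ⊗ (D ⊗ A) ⊕ D ⊗ B       ≈⟨ ⊕-congʳ _ (⊗-assoc s D A) ⟨
      s ⊗ D ⊗ A ⊕ D ⊗ B         ≈⟨ ⊕-congʳ _ (⊗-congʳ A (⊗-comm s D)) ⟩
      D ⊗ s ⊗ A ⊕ D ⊗ B         ≈⟨ ⊕-congʳ _ (⊗-assoc D s A) ⟩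
      D ⊗ (s ⊗ A) ⊕ D ⊗ B       ≈⟨ ⊗-distribˡ-⊕ D (s ⊗ A) B ⟨
      D ⊗ (s ⊗ A ⊕ B)           ∎
      where open ≈-Reasoning

-- Deleting ∞ from a permutation of the projective line

module Contraction {A : Set} where

  -- The inner default x is a junk value: it is reached only if f takes nothing twice.
  contract : (Maybe A → Maybe A) → A → A
  contract f x = Maybe.fromMaybe (Maybe.fromMaybe x (f nothing)) (f (just x))

  -- If f sends x to ∞, its contraction sends x to f(∞); g sends f(∞) to ∞ and ∞ to x, so
  -- contracting g skips the same detour. Hypothesis and conclusion are both one-sided, and
  -- exchanging f with its inverse gives the other side.
  contract-inverse : ∀ {f g} → (∀ x → g (f x) ≡ x) → ∀ x → contract g (contract f x) ≡ x
  contract-inverse {f} {g} g∘f≗id x with f (just x) in fx | f nothing in f∞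
  ... | just y  | _ rewrite trans (cong g (sym fx)) (g∘f≗id (just x)) = refl
  ... | nothing | just y rewrite trans (cong g (sym f∞)) (g∘f≗id nothing)
                               | trans (cong g (sym fx)) (g∘f≗id (just x)) = refl
  ... | nothing | nothing
    with () ← trans (sym (g∘f≗id nothing)) (trans (cong g (trans f∞ (sym fx))) (g∘f≗id (just x)))

  module _ {f : Maybe A → Maybe A} (f-bij : Bijective _≡_ _≡_ f) where

    preimage : Maybe A → Maybe A
    preimage y = proj₁ (proj₂ f-bij y)

    f∘preimage : ∀ y → f (preimage y) ≡ y
    f∘preimage y = proj₂ (proj₂ f-bij y) refl

    preimage∘f : ∀ x → preimage (f x) ≡ x
    preimage∘f x = proj₁ f-bij (f∘preimage (f x))

    contract-↔ : A ↔ A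
    contract-↔ = mk↔ₛ′ (contract f) (contract preimage)
      (contract-inverse {preimage} {f} f∘preimage) (contract-inverse {f} {preimage} preimage∘f)

    -- A list with at most one entry: two of them concatenate to the exceptional points of a pair of
    -- functions, and the length is the number e.
    poles : List A
    poles = fromMaybe (preimage nothing)

    length-poles-≤1 : length poles ≤ 1
    length-poles-≤1 with preimage nothing
    ... | just _  = s≤s z≤n
    ... | nothing = z≤n

    ∈-poles : ∀ {x} → f (just x) ≡ nothing → x ∈ poles
    ∈-poles {x} fx≡∞ rewrite trans (cong preimage (sym fx≡∞)) (preimage∘f (just x)) = here refl

    f∞≡∞⇒length-poles≡0 : f nothing ≡ nothing → length poles ≡ 0
    f∞≡∞⇒length-poles≡0 f∞≡∞ rewrite trans (cong preimage (sym f∞≡∞)) (preimage∘f nothing) = refl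

  contract-agree : ∀ {f g x} → contract f x ≡ contract g x →
    f (just x) ≡ g (just x) ⊎ (f (just x) ≡ nothing ⊎ g (just x) ≡ nothing)
  contract-agree {f} {g} {x} eq with f (just x) | g (just x)
  ... | just y  | just y′ = inj₁ (cong just eq)
  ... | just y  | nothing = inj₂ (inj₂ refl)
  ... | nothing | _       = inj₂ (inj₁ refl)

open Contraction

-- Agreements of two rational functions

module RationalFunctions {q : ℕ} (F : FiniteField q) where
  open FiniteField F
  open Polynomials F
  open Degree

  Rat : Set
  Rat = RatFun F

  ⟦_⟧ᵣ : Rat → ℙ¹ F → ℙ¹ F
  ⟦_⟧ᵣ = ⟦_⟧ F

  infix 4 _~_
  _~_ : Rat → Rat → Set
  _~_ = _≈ᵣ_ F

  -- Coprimality bounds the length of `W` by that of the polynomial 1, once `W`, `A` and `B` are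
  -- replaced by normalised lists; these exist because V and U are nonzero.
  commonDivisor-constant : ∀ {V U v u} W A B → Degree V v → Degree U u → Coprime F V U →
    V ≈ W ⊗ A → U ≈ W ⊗ B → ∃ λ w → w ≢ 0# × W ≈ w ∷ []
  commonDivisor-constant {V} {U} W A B deg-V deg-U coprime V≈WA U≈WB
    with normalise W | normalise A | normalise B
  ... | inj₁ W≈[] | _ | _ = ⊥-elim (Degree⇒≉[] deg-V (≈-trans V≈WA (⊗-congʳ A W≈[])))
  ... | _ | inj₁ A≈[] | _ = ⊥-elim (Degree⇒≉[] deg-V
    (≈-trans V≈WA (≈-trans (⊗-congˡ W A≈[]) (⊗-zeroʳ W))))
  ... | _ | _ | inj₁ B≈[] = ⊥-elim (Degree⇒≉[] deg-U
    (≈-trans U≈WB (≈-trans (⊗-congˡ W B≈[]) (⊗-zeroʳ W))))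
  ... | inj₂ (W′ , _ , W′≈W , deg-W′) | inj₂ (A′ , _ , A′≈A , deg-A′) | inj₂ (B′ , _ , B′≈B , deg-B′) =
    constant W′ W′≈W deg-W′ (∣ₚ⇒length≤ F W′ (1# ∷ []) (coprime W′
      (A′ , Degree-≈⇒≡ (Degree-⊗ deg-W′ deg-A′) deg-V (≈-trans (⊗-cong W′≈W A′≈A) (≈-sym V≈WA)))
      (B′ , Degree-≈⇒≡ (Degree-⊗ deg-W′ deg-B′) deg-U (≈-trans (⊗-cong W′≈W B′≈B) (≈-sym U≈WB)))))
    where
    constant : ∀ {n} X → X ≈ W → Degree X n → length X ≤ 1 → ∃ λ w → w ≢ 0# × W ≈ w ∷ []
    constant []      X≈W deg-X _ with () ← length≡ deg-X
    constant (w ∷ []) X≈W deg-X _ = w , lead≢0 deg-X , ≈-sym X≈W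
    constant (_ ∷ _ ∷ _) _ _ (s≤s ())

  Degree-· : ∀ {c p n} → c ≢ 0# → Degree p n → Degree (c · p) n
  Degree-· {c} {p} {n} c≢0 deg = degree (|cp|≡ , subst (_≢ 0#)
    (sym (trans (lead≡coeff (c · p) |cp|≡) (coeff-· c p n))) (*-nonzero c≢0 (Degree⇒coeff≢0 deg)))
    where
    |cp|≡ = trans (length-map (c *_) p) (length≡ deg)

  -- Both multipliers are nonzero constants w and c, so (R, T) is (V, U) scaled by c/w.
  coprime-commonShape⇒~ : ∀ {V U R T v u r t} →
    Degree V v → Degree U u → Degree R r → Degree T t → Coprime F V U → Coprime F R T →
    CommonShape V U R T → (V , U) ~ (R , T)
  coprime-commonShape⇒~ deg-V deg-U deg-R deg-T coprime coprime′
    record { W = W ; C = C ; A = A ; B = B ; V≈WA = V≈WA ; U≈WB = U≈WB ; R≈CA = R≈CA ; T≈CB = T≈CB }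
    with commonDivisor-constant W A B deg-V deg-U coprime V≈WA U≈WB
       | commonDivisor-constant C A B deg-R deg-T coprime′ R≈CA T≈CB
  ... | w , w≢0 , W≈w | c , c≢0 , C≈c = c * w ⁻¹ , c/w≢0 ,
    rescale deg-V deg-R V≈WA R≈CA , rescale deg-U deg-T U≈WB T≈CB
    where
    w⁻¹*w≡1 : w ⁻¹ * w ≡ 1#
    w⁻¹*w≡1 = trans (K.*-comm _ _) (*-inverseʳ w w≢0)
    c/w*w≡c : c * w ⁻¹ * w ≡ c
    c/w*w≡c = trans (K.*-assoc c _ w) (trans (cong (c *_) w⁻¹*w≡1) (K.*-identityʳ c))
    c/w≢0 : c * w ⁻¹ ≢ 0#
    c/w≢0 c/w≡0 = c≢0 (trans (sym c/w*w≡c) (trans (cong (_* w) c/w≡0) (K.zeroˡ w)))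
    rescale : ∀ {P Q X m n} → Degree P m → Degree Q n → P ≈ W ⊗ X → Q ≈ C ⊗ X →
      Q ≡ (c * w ⁻¹) · P
    rescale {P} {Q} {X} deg-P deg-Q P≈WX Q≈CX = Degree-≈⇒≡ deg-Q (Degree-· c/w≢0 deg-P) (begin
      Q                              ≈⟨ Q≈CX ⟩
      C ⊗ X                          ≈⟨ ⊗-congʳ X C≈c ⟩
      (c ∷ []) ⊗ X                   ≈⟨ constant-⊗ c X ≈-refl ⟩
      c · X                          ≡⟨ cong (_· X) c/w*w≡c ⟨
      (c * w ⁻¹ * w) · X             ≈⟨ ·-* (c * w ⁻¹) w X ⟨
      (c * w ⁻¹) · (w · X)           ≈⟨ ·-cong (constant-⊗ w X ≈-refl) ⟨
      (c * w ⁻¹) · ((w ∷ []) ⊗ X)    ≈⟨ ·-cong (⊗-congʳ X W≈w) ⟨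
      (c * w ⁻¹) · (W ⊗ X)           ≈⟨ ·-cong P≈WX ⟨
      (c * w ⁻¹) · P                 ∎)
      where open ≈-Reasoning

  coprime-proportional⇒~ : ∀ {V U R T v u r t} →
    Degree V v → Degree U u → Degree R r → Degree T t → Coprime F V U → Coprime F R T →
    V ⊗ T ≈ R ⊗ U → (V , U) ~ (R , T)
  coprime-proportional⇒~ {V} {U} {R} {T} deg-V deg-U deg-R deg-T coprime coprime′ VT≈RU =
    coprime-commonShape⇒~ deg-V deg-U deg-R deg-T coprime coprime′
      (proportional⇒commonShape _ {V} {U} {R} {T} (Degree⇒≉[] deg-V) (Degree⇒below deg-U) VT≈RU)

  -- The numerator of V/U - R/T over the denominator UT.
  crossDifference : Rat → Rat → Pol
  crossDifference (V , U) (R , T) = V ⊗ T ⊕ ⊝ (R ⊗ U)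

  crossDifference-root : ∀ r s x → ⟦ r ⟧ᵣ (just x) ≡ ⟦ s ⟧ᵣ (just x) → ⟦ r ⟧ᵣ (just x) ≢ nothing →
    Root (crossDifference r s) x
  crossDifference-root (V , U) (R , T) x eq finite with ev U x ≟ 0# | ev T x ≟ 0#
  ... | yes _     | _         = ⊥-elim (finite refl)
  ... | no  _     | yes _     with () ← eq
  ... | no  U≢0   | no  T≢0   = begin
    ev (V ⊗ T ⊕ ⊝ (R ⊗ U)) x              ≡⟨ eval-⊕ (V ⊗ T) _ x ⟩
    ev (V ⊗ T) x + ev (⊝ (R ⊗ U)) x       ≡⟨ cong (ev (V ⊗ T) x +_) (eval-⊝ (R ⊗ U) x) ⟩
    ev (V ⊗ T) x + - ev (R ⊗ U) x         ≡⟨ cong₂ (λ y z → y + - z) (eval-⊗ V T x) (eval-⊗ R U x) ⟩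
    V[x] * T[x] + - (R[x] * U[x])         ≡⟨ cong (λ y → y + - (R[x] * U[x])) cross ⟩
    R[x] * U[x] + - (R[x] * U[x])         ≡⟨ K.-‿inverseʳ _ ⟩
    0#                                    ∎
    where
    open ≡-Reasoning
    V[x] = ev V x
    U[x] = ev U x
    R[x] = ev R x
    T[x] = ev T x
    clear : ∀ {a b} → b ≢ 0# → a ≡ a * b ⁻¹ * b
    clear {a} {b} b≢0 = sym (trans (K.*-assoc a _ b)
      (trans (cong (a *_) (trans (K.*-comm _ b) (*-inverseʳ b b≢0))) (K.*-identityʳ a)))
    cross : V[x] * T[x] ≡ R[x] * U[x]
    cross = begin
      V[x] * T[x]                       ≡⟨ cong (_* T[x]) (clear U≢0) ⟩
      V[x] * U[x] ⁻¹ * U[x] * T[x]      ≡⟨ cong (λ y → y * U[x] * T[x]) (Maybe.just-injective eq) ⟩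
      R[x] * T[x] ⁻¹ * U[x] * T[x]      ≡⟨ K.*-assoc _ _ _ ⟩
      R[x] * T[x] ⁻¹ * (U[x] * T[x])    ≡⟨ cong (R[x] * T[x] ⁻¹ *_) (K.*-comm _ _) ⟩
      R[x] * T[x] ⁻¹ * (T[x] * U[x])    ≡⟨ K.*-assoc _ _ _ ⟨
      R[x] * T[x] ⁻¹ * T[x] * U[x]      ≡⟨ cong (_* U[x]) (clear T≢0) ⟨
      R[x] * U[x]                       ∎

  contractionPerm : ∀ {r} → Bijective _≡_ _≡_ ⟦ r ⟧ᵣ → Permutation′ q
  contractionPerm bij = enumeration ↔-∘ (contract-↔ bij ↔-∘ ↔-sym enumeration)

  agreeingPoints-≤ : ∀ r s (r-bij : Bijective _≡_ _≡_ ⟦ r ⟧ᵣ) (s-bij : Bijective _≡_ _≡_ ⟦ s ⟧ᵣ) {n xs} →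
    ¬ (crossDifference r s ≈ []) → crossDifference r s below suc n → Unique xs →
    All (λ x → contract ⟦ r ⟧ᵣ x ≡ contract ⟦ s ⟧ᵣ x) xs →
    length xs ≤ n ℕ.+ (length (poles r-bij) ℕ.+ length (poles s-bij))
  agreeingPoints-≤ r s r-bij s-bij {n} {xs} Δ≉[] Δ<1+n xs! agree = begin
    length xs                                  ≡⟨ length-filter-complement root? xs ⟨
    length (filter root? xs) ℕ.+ length (filter (¬? ∘ root?) xs)
      ≤⟨ ℕ.+-mono-≤ (roots-≤-degree Δ≉[] Δ<1+n (Unique.filter⁺ root? xs!) (All.all-filter root? xs))
                    (Unique-⊆⇒length-≤ (Unique.filter⁺ (¬? ∘ root?) xs!) nonroots-are-poles) ⟩
    n ℕ.+ length (poles r-bij ++ poles s-bij)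
      ≡⟨ cong (n ℕ.+_) (length-++ (poles r-bij)) ⟩
    n ℕ.+ (length (poles r-bij) ℕ.+ length (poles s-bij)) ∎
    where
    open ℕ.≤-Reasoning
    root? = λ x → ev (crossDifference r s) x ≟ 0#

    pole : ∀ {x} → ¬ Root (crossDifference r s) x × contract ⟦ r ⟧ᵣ x ≡ contract ⟦ s ⟧ᵣ x →
      x ∈ poles r-bij ++ poles s-bij
    pole {x} (nonroot , eq) with contract-agree {f = ⟦ r ⟧ᵣ} {⟦ s ⟧ᵣ} {x} eq
    ... | inj₂ (inj₁ rx≡∞) = ∈-++⁺ˡ (∈-poles r-bij rx≡∞)
    ... | inj₂ (inj₂ sx≡∞) = ∈-++⁺ʳ (poles r-bij) (∈-poles s-bij sx≡∞)
    -- A common value of the two functions may still be ∞, which makes the point a pole; only a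
    -- finite one yields a root of the cross difference.
    ... | inj₁ rx≡sx with _≟∞_ F (⟦ r ⟧ᵣ (just x)) nothing
    ... | yes rx≡∞ = ∈-++⁺ˡ (∈-poles r-bij rx≡∞)
    ... | no  rx≢∞ = ⊥-elim (nonroot (crossDifference-root r s x rx≡sx rx≢∞))

    nonroots-are-poles : All (_∈ poles r-bij ++ poles s-bij) (filter (¬? ∘ root?) xs)
    nonroots-are-poles = All.zipWith pole
      (All.all-filter (¬? ∘ root?) xs , All.filter⁺ (¬? ∘ root?) agree)

  hd-contractionPerm : ∀ r s (r-bij : Bijective _≡_ _≡_ ⟦ r ⟧ᵣ) (s-bij : Bijective _≡_ _≡_ ⟦ s ⟧ᵣ) {n m} →
    ¬ (crossDifference r s ≈ []) → crossDifference r s below suc n →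
    n ℕ.+ (length (poles r-bij) ℕ.+ length (poles s-bij)) ≤ m →
    q ∸ m ≤ hd (contractionPerm {r} r-bij) (contractionPerm {s} s-bij)
  hd-contractionPerm r s r-bij s-bij Δ≉[] Δ<1+n bound = agreements≤⇒hd≥ π σ
    (ℕ.≤-trans (ℕ.≤-reflexive (sym (length-map from (agreements π σ))))
    (ℕ.≤-trans (agreeingPoints-≤ r s r-bij s-bij Δ≉[] Δ<1+n
      (Unique.map⁺ from-injective (Unique.filter⁺ agree? (Unique.allFin⁺ q)))
      (All.map⁺ (All.map to-injective (All.all-filter agree? (allFin q))))) bound))
    where
    open Inverse enumeration using (to; from; strictlyInverseˡ; strictlyInverseʳ)
    π = contractionPerm {r} r-bij
    σ = contractionPerm {s} s-bij
    agree? = λ x → π ⟨$⟩ʳ x Fin.≟ σ ⟨$⟩ʳ x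
    from-injective : ∀ {i j} → from i ≡ from j → i ≡ j
    from-injective eq = trans (sym (strictlyInverseˡ _)) (trans (cong to eq) (strictlyInverseˡ _))
    to-injective : ∀ {x y} → to x ≡ to y → x ≡ y
    to-injective eq = trans (sym (strictlyInverseʳ _)) (trans (cong from eq) (strictlyInverseʳ _))

  ⟦⟧-∞ : ∀ {V U v u} → HasDegree F V v → HasDegree F U u → u < v → ⟦ V , U ⟧ᵣ nothing ≡ nothing
  ⟦⟧-∞ {V} {U} (|V|≡1+v , _) (|U|≡1+u , _) u<v with ℕ.<-cmp (length V) (length U)
  ... | tri< |V|<|U| _ _ = ⊥-elim (ℕ.<-asym u<v
    (ℕ.s<s⁻¹ (subst (_< _) |V|≡1+v (subst (_ <_) |U|≡1+u |V|<|U|))))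
  ... | tri≈ _ |V|≡|U| _ = ⊥-elim (ℕ.<-irrefl
    (ℕ.suc-injective (trans (sym |U|≡1+u) (trans (sym |V|≡|U|) |V|≡1+v))) u<v)
  ... | tri> _ _ _ = refl

  -- Permutation rational functions and their distances

  record PRF (v u : ℕ) (r : Rat) : Set where
    constructor isPRF
    field proof : IsPRF F v u r

    numerator-degree : Degree (proj₁ r) v
    numerator-degree = degree (proj₁ proof)

    denominator-degree : Degree (proj₂ r) u
    denominator-degree = degree (proj₁ (proj₂ proof))

    coprime : Coprime F (proj₁ r) (proj₂ r)
    coprime = proj₁ (proj₂ (proj₂ proof))

    bijective : Bijective _≡_ _≡_ ⟦ r ⟧ᵣ
    bijective = proj₂ (proj₂ (proj₂ proof))

    poleCount : ℕ
    poleCount = length (poles bijective)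

    poleCount≡0 : u < v → poleCount ≡ 0
    poleCount≡0 u<v = f∞≡∞⇒length-poles≡0 bijective
      (⟦⟧-∞ (hasDegree numerator-degree) (hasDegree denominator-degree) u<v)
  open PRF

  module _ {r s : Rat} {v u v′ u′ : ℕ} (r-prf : PRF v u r) (s-prf : PRF v′ u′ s) where

    private
      V = proj₁ r
      U = proj₂ r
      R = proj₁ s
      T = proj₂ s
      deg-V = numerator-degree r-prf
      deg-U = denominator-degree r-prf
      deg-R = numerator-degree s-prf
      deg-T = denominator-degree s-prf

    crossDifference≉[] : ¬ (r ~ s) → ¬ (crossDifference r s ≈ [])
    crossDifference≉[] r≁s Δ≈[] = r≁s (coprime-proportional⇒~ deg-V deg-U deg-R deg-T
      (coprime r-prf) (coprime s-prf)
      (p⊕⊝r≈[]⇒p≈r {V ⊗ T} {R ⊗ U} Δ≈[]))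

    crossDifference-below : ∀ {n} → v ℕ.+ u′ ≤ n → v′ ℕ.+ u ≤ n → crossDifference r s below suc n
    crossDifference-below v+u′≤n v′+u≤n = below-⊕
      (below-mono (s≤s v+u′≤n) (below-⊗ (Degree⇒below deg-V) (Degree⇒below deg-T)))
      (below-⊝ (below-mono (s≤s v′+u≤n) (below-⊗ (Degree⇒below deg-R) (Degree⇒below deg-U))))

    crossDifference-below-monic : ∀ {n} → v ℕ.+ u′ ≡ suc n → v′ ℕ.+ u ≡ suc n →
      Monic F V → Monic F U → Monic F R → Monic F T → crossDifference r s below suc n
    crossDifference-below-monic {n} v+u′≡1+n v′+u≡1+n V-monic U-monic R-monic T-monic = below-suc
      (crossDifference-below (ℕ.≤-reflexive v+u′≡1+n) (ℕ.≤-reflexive v′+u≡1+n))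
      (begin
      coeff (V ⊗ T ⊕ ⊝ (R ⊗ U)) (suc n)                    ≡⟨ coeff-⊕ (V ⊗ T) _ (suc n) ⟩
      coeff (V ⊗ T) (suc n) + coeff (⊝ (R ⊗ U)) (suc n)
        ≡⟨ cong (coeff (V ⊗ T) (suc n) +_) (coeff-⊝ (R ⊗ U) (suc n)) ⟩
      coeff (V ⊗ T) (suc n) + - coeff (R ⊗ U) (suc n)
        ≡⟨ cong₂ (λ x y → x + - y) (top deg-V deg-T V-monic T-monic v+u′≡1+n)
                                   (top deg-R deg-U R-monic U-monic v′+u≡1+n) ⟩
      1# + - 1#                                            ≡⟨ K.-‿inverseʳ 1# ⟩
      0#                                                   ∎)
      where
      open ≡-Reasoning
      top : ∀ {p s a b} → Degree p a → Degree s b → Monic F p → Monic F s → a ℕ.+ b ≡ suc n →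
        coeff (p ⊗ s) (suc n) ≡ 1#
      top {p} {s} {a} {b} deg-p deg-s p-monic s-monic a+b≡1+n = begin
        coeff (p ⊗ s) (suc n)     ≡⟨ cong (coeff (p ⊗ s)) a+b≡1+n ⟨
        coeff (p ⊗ s) (a ℕ.+ b)   ≡⟨ coeff-⊗ (Degree⇒below deg-p) (Degree⇒below deg-s) ⟩
        coeff p a * coeff s b     ≡⟨ cong₂ _*_ (trans (sym (lead≡coeff p (length≡ deg-p))) p-monic)
                                               (trans (sym (lead≡coeff s (length≡ deg-s))) s-monic) ⟩
        1# * 1#                   ≡⟨ K.*-identityʳ 1# ⟩
        1#                        ∎

  -- Scaling keeps list lengths, so a class belongs to one pair of degrees: no function is counted
  -- twice within the sum, nor in both summands of the bound.
  ~⇒degrees≡ : ∀ {r s v u v′ u′} → PRF v u r → PRF v′ u′ s → r ~ s → v ≡ v′ × u ≡ u′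
  ~⇒degrees≡ r-prf s-prf (c , _ , refl , refl) =
    same (numerator-degree r-prf) (numerator-degree s-prf) ,
    same (denominator-degree r-prf) (denominator-degree s-prf)
    where
    same : ∀ {p m n} → Degree p m → Degree (c · p) n → m ≡ n
    same {p} deg deg′ = ℕ.suc-injective
      (trans (sym (length≡ deg)) (trans (sym (length-map (c *_) p)) (length≡ deg′)))

  -- Junk value: the identity when r does not permute the projective line.
  toPermutation : Rat → Permutation′ q
  toPermutation r with bijective? F ⟦ r ⟧ᵣ
  ... | yes bij = contractionPerm {r} bij
  ... | no  _   = Perm.id

  toPermutation-≈ : ∀ {r} (bij : Bijective _≡_ _≡_ ⟦ r ⟧ᵣ) → toPermutation r ≈π contractionPerm {r} bij
  toPermutation-≈ {r} bij x with bijective? F ⟦ r ⟧ᵣ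
  ... | yes _    = refl
  ... | no  ¬bij = ⊥-elim (¬bij bij)

  record Far (D : ℕ) (r s : Rat) : Set where
    constructor far
    field D≤hd : D ≤ hd (toPermutation r) (toPermutation s)

  below⇒far : ∀ {r s v u v′ u′ n m} (r-prf : PRF v u r) (s-prf : PRF v′ u′ s) →
    ¬ (r ~ s) → crossDifference r s below suc n →
    n ℕ.+ (poleCount r-prf ℕ.+ poleCount s-prf) ≤ m → Far (q ∸ m) r s
  below⇒far {r} {s} {m = m} r-prf s-prf r≁s Δ<1+n bound = far (subst (q ∸ m ≤_)
    (sym (hd-cong {π = toPermutation r} {contractionPerm {r} r-bij}
                  {toPermutation s} {contractionPerm {s} s-bij}
                  (toPermutation-≈ {r} r-bij) (toPermutation-≈ {s} s-bij)))
    (hd-contractionPerm r s r-bij s-bij (crossDifference≉[] r-prf s-prf r≁s) Δ<1+n bound))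
    where
    r-bij = bijective r-prf
    s-bij = bijective s-prf

  -- The bound (v + u′) + (e + e′) regroups as (v + e) + (u′ + e′), and likewise with the roles
  -- exchanged, so that each function enters only through its two degrees increased by its own pole
  -- count.
  degrees⇒far : ∀ {r s v u v′ u′ m} (r-prf : PRF v u r) (s-prf : PRF v′ u′ s) → ¬ (r ~ s) →
    (v ℕ.+ poleCount r-prf) ℕ.+ (u′ ℕ.+ poleCount s-prf) ≤ m →
    (v′ ℕ.+ poleCount s-prf) ℕ.+ (u ℕ.+ poleCount r-prf) ≤ m → Far (q ∸ m) r s
  degrees⇒far {v = v} {u} {v′} {u′} {m} r-prf s-prf r≁s bound bound′ = below⇒far r-prf s-prf r≁s
    (crossDifference-below r-prf s-prf (ℕ.m≤m⊔n (v ℕ.+ u′) (v′ ℕ.+ u)) (ℕ.m≤n⊔m (v ℕ.+ u′) (v′ ℕ.+ u)))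
    (begin
      (v ℕ.+ u′) ⊔ (v′ ℕ.+ u) ℕ.+ (e ℕ.+ e′)
        ≡⟨ ℕ.+-distribʳ-⊔ (e ℕ.+ e′) (v ℕ.+ u′) (v′ ℕ.+ u) ⟩
      (v ℕ.+ u′ ℕ.+ (e ℕ.+ e′)) ⊔ (v′ ℕ.+ u ℕ.+ (e ℕ.+ e′))
        ≡⟨ cong₂ _⊔_ (ℕ+-interchange v u′ e e′)
             (trans (cong (v′ ℕ.+ u ℕ.+_) (ℕ.+-comm e e′)) (ℕ+-interchange v′ u e′ e)) ⟩
      (v ℕ.+ e ℕ.+ (u′ ℕ.+ e′)) ⊔ (v′ ℕ.+ e′ ℕ.+ (u ℕ.+ e))
        ≤⟨ ℕ.⊔-lub bound bound′ ⟩
      m ∎)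
    where
    open ℕ.≤-Reasoning
    open CommutativeSemigroupProperties ℕ.+-commutativeSemigroup
      using () renaming (interchange to ℕ+-interchange)
    e  = poleCount r-prf
    e′ = poleCount s-prf

  -- The code and its size

  prfs : ℕ × ℕ → List Rat
  prfs (v , u) = deduplicate (_≈ᵣ?_ F) (filter (isPRF? F v u) (candidates F v u))

  monicPRFs : ℕ → ℕ → List Rat
  monicPRFs v u = deduplicate (_≈ᵣ?_ F) (filter (isMonicPRF? F v u) (candidates F v u))

  prfs-all : ∀ p → All (PRF (proj₁ p) (proj₂ p)) (prfs p)
  prfs-all (v , u) = All.deduplicate⁺ (_≈ᵣ?_ F)
    (All.map isPRF (All.all-filter (isPRF? F v u) (candidates F v u)))

  MonicPRF : ℕ → ℕ → Rat → Set
  MonicPRF v u r = PRF v u r × Monic F (proj₁ r) × Monic F (proj₂ r)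

  monicPRFs-all : ∀ v u → All (MonicPRF v u) (monicPRFs v u)
  monicPRFs-all v u = All.deduplicate⁺ (_≈ᵣ?_ F) (All.map (λ (prf , monic) → isPRF prf , monic)
    (All.all-filter (isMonicPRF? F v u) (candidates F v u)))

  deduplicate-≁ : ∀ rs → AllPairs (λ r s → ¬ (r ~ s)) (deduplicate (_≈ᵣ?_ F) rs)
  deduplicate-≁ []       = []
  deduplicate-≁ (r ∷ rs) =
    All.all-filter (¬? ∘ _≈ᵣ?_ F r) (deduplicate (_≈ᵣ?_ F) rs)
    ∷ AllPairs.filter⁺ (¬? ∘ _≈ᵣ?_ F r) (deduplicate-≁ rs)

  concatMap-prfs-≁ : ∀ {ps} → Unique ps → AllPairs (λ r s → ¬ (r ~ s)) (concatMap prfs ps)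
  concatMap-prfs-≁ {ps} ps! = AllPairs.concat⁺
    (All.map⁺ (All.universal (λ p → deduplicate-≁ _) ps))
    (AllPairs.map⁺ (AllPairs.map (λ {p} {p′} p≢p′ →
      All.map (λ r-prf → All.map (λ s-prf r~s → p≢p′ (
        let v≡v′ , u≡u′ = ~⇒degrees≡ r-prf s-prf r~s in cong₂ _,_ v≡v′ u≡u′)) (prfs-all p′)) (prfs-all p))
      ps!))

  module _ (k : ℕ) where

    -- The strict inequality pays for `Top`: against a numerator of degree k + 1 and no finite pole,
    -- (k + 1) + (u + e) must not exceed 2k.
    Regular : Rat → Set
    Regular r = ∃₂ λ v u → Σ (PRF v u r) λ prf →
      v ℕ.+ poleCount prf ≤ k × u ℕ.+ poleCount prf < k

    Top : Rat → Set
    Top = MonicPRF (suc k) k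

    Regular⇒≁Top : ∀ {r s} → Regular r → Top s → ¬ (r ~ s)
    Regular⇒≁Top (v , u , r-prf , v+e≤k , _) (s-prf , _) r~s =
      ℕ.<⇒≱ (ℕ.n<1+n k) (subst (_≤ k) (proj₁ (~⇒degrees≡ r-prf s-prf r~s)) (ℕ.m+n≤o⇒m≤o v v+e≤k))

    Regular-far : ∀ {r s} → Regular r → Regular s → ¬ (r ~ s) → Far (q ∸ (k ℕ.+ k)) r s
    Regular-far (_ , _ , r-prf , v+e≤k , u+e<k) (_ , _ , s-prf , v′+e′≤k , u′+e′<k) r≁s =
      degrees⇒far r-prf s-prf r≁s (ℕ.+-mono-≤ v+e≤k (ℕ.<⇒≤ u′+e′<k)) (ℕ.+-mono-≤ v′+e′≤k (ℕ.<⇒≤ u+e<k))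

    Top-poleCount : ∀ {s} (s-top : Top s) → poleCount (proj₁ s-top) ≡ 0
    Top-poleCount (s-prf , _) = poleCount≡0 s-prf (ℕ.n<1+n k)

    Regular-Top-far : ∀ {r s} → Regular r → Top s → ¬ (r ~ s) → Far (q ∸ (k ℕ.+ k)) r s
    Regular-Top-far (v , u , r-prf , v+e≤k , u+e<k) s-top@(s-prf , _) r≁s =
      degrees⇒far r-prf s-prf r≁s
        (ℕ.+-mono-≤ v+e≤k (subst (λ e′ → k ℕ.+ e′ ≤ k) (sym e′≡0) (ℕ.≤-reflexive (ℕ.+-identityʳ k))))
        (subst (λ e′ → suc k ℕ.+ e′ ℕ.+ (u ℕ.+ e) ≤ k ℕ.+ k) (sym e′≡0)
          (subst (λ x → suc x ℕ.+ (u ℕ.+ e) ≤ k ℕ.+ k) (sym (ℕ.+-identityʳ k))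
            (subst (_≤ k ℕ.+ k) (ℕ.+-suc k (u ℕ.+ e)) (ℕ.+-monoʳ-≤ k u+e<k))))
      where
      e = poleCount r-prf
      e′≡0 = Top-poleCount s-top

    -- Degrees alone would allow 2k + 1 agreements, one too many; the cancelled top term brings the
    -- count back to 2k. This is why only monic pairs are taken in these degrees.
    Top-far : ∀ {r s} → Top r → Top s → ¬ (r ~ s) → Far (q ∸ (k ℕ.+ k)) r s
    Top-far r-top@(r-prf , V-monic , U-monic) s-top@(s-prf , R-monic , T-monic) r≁s =
      below⇒far r-prf s-prf r≁s
        (crossDifference-below-monic r-prf s-prf refl refl V-monic U-monic R-monic T-monic)
        (ℕ.≤-reflexive (trans (cong (k ℕ.+ k ℕ.+_) (cong₂ ℕ._+_ (Top-poleCount r-top) (Top-poleCount s-top)))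
          (ℕ.+-identityʳ (k ℕ.+ k))))

    far-code : ∀ {rs ss} → All Regular rs → AllPairs (λ r s → ¬ (r ~ s)) rs →
      All Top ss → AllPairs (λ r s → ¬ (r ~ s)) ss → AllPairs (Far (q ∸ (k ℕ.+ k))) (rs ++ ss)
    far-code rs-regular rs-≁ ss-top ss-≁ = AllPairs.++⁺
      (AllPairs-mapWith Regular-far rs-regular rs-≁)
      (AllPairs-mapWith Top-far ss-top ss-≁)
      (All.map (λ r-regular → All.map (λ s-top →
        Regular-Top-far r-regular s-top (Regular⇒≁Top r-regular s-top)) ss-top) rs-regular)

  code-size-≤-M : ∀ {k ps} → k ℕ.+ k < q → Unique ps → All (Regular k) (concatMap prfs ps) →
    sum (map (λ (v , u) → N F v u) ps) ℕ.+ Nᵐ F (suc k) k ≤ M q (q ∸ (k ℕ.+ k))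
  code-size-≤-M {k} {ps} 2k<q ps! regular = subst (_≤ M q (q ∸ (k ℕ.+ k))) size
    (code⇒length≤M (map toPermutation code) (ℕ.m<n⇒0<n∸m 2k<q)
      (AllPairs.map⁺ (AllPairs.map Far.D≤hd (far-code k regular (concatMap-prfs-≁ ps!)
        (monicPRFs-all (suc k) k) (deduplicate-≁ _)))))
    where
    code = concatMap prfs ps ++ monicPRFs (suc k) k
    open ≡-Reasoning
    size : length (map toPermutation code) ≡ sum (map (λ (v , u) → N F v u) ps) ℕ.+ Nᵐ F (suc k) k
    size = begin
      length (map toPermutation code)     ≡⟨ length-map toPermutation code ⟩
      length code                         ≡⟨ length-++ (concatMap prfs ps) ⟩
      length (concatMap prfs ps) ℕ.+ Nᵐ F (suc k) k
        ≡⟨ cong (ℕ._+ Nᵐ F (suc k) k) (length-concatMap prfs ps) ⟩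
      sum (map (length ∘ prfs) ps) ℕ.+ Nᵐ F (suc k) k ∎

  -- Here j stands for (d - 3)/2 = k - 2. When deg V ≤ deg U, one of the two units between j and k
  -- covers a possible finite pole, the other the strict inequality of `Regular`.
  admissible⇒Regular : ∀ j {v u r} → (u < v → v ≤ 2 ℕ.+ j) → (v ≤ u → u ≤ j) →
    PRF v u r → Regular (2 ℕ.+ j) r
  admissible⇒Regular j {v} {u} {r} big small prf = v , u , prf , bounds (ℕ.<-≤-connex u v)
    where
    e = poleCount prf
    bounds : u < v ⊎ v ≤ u → v ℕ.+ e ≤ 2 ℕ.+ j × u ℕ.+ e < 2 ℕ.+ j
    bounds (inj₁ u<v) = subst (λ e → v ℕ.+ e ≤ 2 ℕ.+ j × u ℕ.+ e < 2 ℕ.+ j) (sym (poleCount≡0 prf u<v))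
      ( subst (_≤ 2 ℕ.+ j) (sym (ℕ.+-identityʳ v)) (big u<v)
      , subst (_< 2 ℕ.+ j) (sym (ℕ.+-identityʳ u)) (ℕ.≤-trans u<v (big u<v)))
    bounds (inj₂ v≤u) = ℕ.m≤n⇒m≤1+n (ℕ.≤-trans (ℕ.+-monoˡ-≤ e v≤u) u+e≤1+j) , s≤s u+e≤1+j
      where
      u+e≤1+j : u ℕ.+ e ≤ suc j
      u+e≤1+j = ℕ.≤-trans (ℕ.+-mono-≤ (small v≤u) (length-poles-≤1 (bijective prf)))
        (ℕ.≤-reflexive (ℕ.+-comm j 1))

-- Parity of d and the conclusion

odd≥3 : ∀ d → d % 2 ≡ 1 → d ≥ 3 → ∃ λ j → d ≡ 3 ℕ.+ j ℕ.* 2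
odd≥3 d d%2≡1 d≥3 with d / 2 | trans (ℕ.m≡m%n+[m/n]*n d 2) (cong (ℕ._+ d / 2 ℕ.* 2) d%2≡1)
... | suc j | d≡1+[1+j]*2 = j , d≡1+[1+j]*2
... | zero  | refl with s≤s () ← d≥3

open import Data.Nat.Base using (_+_)

theorem4p10 : ∀ (d : ℕ) → d % 2 ≡ 1 → d ≥ 3 →
    ∀ (q : ℕ) → IsPrimePower q → q ≥ d + 2 →
    ∀ (F : FiniteField q) →
    M q (q ∸ d ∸ 1) ≥ S F d + Nᵐ F ((d + 3) / 2) ((d + 1) / 2)
theorem4p10 d d-odd d≥3 q _ q≥d+2 F with odd≥3 d d-odd d≥3
... | j , refl = subst (λ D → S F d + Nᵐ F ((d + 3) / 2) ((d + 1) / 2) ≤ M q D)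
  (trans (cong (q ∸_) 2k≡d+1) (sym (ℕ.∸-+-assoc q d 1)))
  (subst (λ (a , b) → S F d + Nᵐ F a b ≤ M q (q ∸ (k + k))) (sym (cong₂ _,_ [d+3]/2≡1+k [d+1]/2≡k))
    (code-size-≤-M {k} 2k<q pairs! regular))
  where
  open RationalFunctions F
  -- With d = 3 + 2j this is (d + 1)/2, while (d - 3)/2 is j.
  k = 2 + j
  [d+1]/2≡k : (d + 1) / 2 ≡ k
  [d+1]/2≡k = trans (cong (_/ 2) (ℕ.+-comm d 1)) (ℕ.m*n/n≡m k 2)
  [d+3]/2≡1+k : (d + 3) / 2 ≡ suc k
  [d+3]/2≡1+k = trans (cong (_/ 2) (ℕ.+-comm d 3)) (ℕ.m*n/n≡m (suc k) 2)
  2k≡d+1 : k + k ≡ d + 1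
  2k≡d+1 = trans (cong (k +_) (sym (ℕ.+-identityʳ k))) (trans (ℕ.*-comm 2 k) (ℕ.+-comm 1 d))
  -- As 2k = d + 1, this is q ≥ d + 2 itself, and it says that the distance q - 2k is positive.
  2k<q : k + k < q
  2k<q = subst (_≤ q) (trans (ℕ.+-suc d 1) (cong suc (sym 2k≡d+1))) q≥d+2
  range = upTo (suc ((d + 1) / 2))
  range! : Unique range
  range! = Unique.upTo⁺ _
  pairs! : Unique (admissiblePairs d)
  pairs! = Unique.filter⁺ (admissible? d) {cartesianProduct range range}
    (Unique.cartesianProduct⁺ range! range!)
  regular : All (Regular k) (concatMap prfs (admissiblePairs d))
  regular = All.concat⁺ (All.map⁺ (All.map (λ {p} (big , small , equal) →
    All.map (admissible⇒Regular j
      (λ u<v → ℕ.≤-trans (big u<v) (ℕ.≤-reflexive [d+1]/2≡k))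
      (λ v≤u → ℕ.≤-trans (≤-small small equal v≤u) (ℕ.≤-reflexive (ℕ.m*n/n≡m j 2)))) (prfs-all p))
    (All.all-filter (admissible? d) (cartesianProduct range range))))
    where
    ≤-small : ∀ {v u b} → (v < u → u ≤ b) → (v ≡ u → u ≤ b) → v ≤ u → u ≤ b
    ≤-small small equal v≤u with ℕ.m≤n⇒m<n∨m≡n v≤u
    ... | inj₁ v<u = small v<u
    ... | inj₂ v≡u = equal v≡u
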